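{- There exists a deterministic single-pass semi-streaming algorithm that, given the edges of a bipartite graph $G$ with $n$ vertices arriving in a uniformly random order, with high probability (in $n$) outputs a matching of $G$ of size at least $\big(\frac{3}{5}-o(1)\big)\mu(G)$, where $\mu(G)$ denotes the size of a maximum matching of $G$.
   Context: A graph stream for a graph $G=(V,E)$ with $n$ vertices and $m$ edges is a sequence $\langle e_1,\dots,e_m\rangle$ in which $(e_1,\dots,e_m)$ is a permutation of $E$; in the random-order model this permutation is chosen uniformly at random among all permutations of $E$. A single-pass semi-streaming algorithm reads the stream once, in order, and uses memory $\tilde{O}(n)$ (i.e. $O(n\,\mathrm{polylog}\, n)$); it must output a matching of $G$ at the end. "With high probability" means with probability at least $1-1/\mathrm{poly}(n)$, and $o(1)$ denotes a quantity tending to $0$ as $n\to\infty$. "Deterministic" means the algorithm makes no random choices; the only randomness is the order of the stream. -}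

module Defs where

open import Data.Bool using (Bool; true; false; _∧_; _∨_; not; if_then_else_)
open import Data.Nat using (ℕ; zero; suc; _+_; _^_; _≤_; _⊔_)
import Data.Nat
open import Data.Nat.Logarithm using (⌊log₂_⌋)
open import Data.Fin using (Fin)
import Data.Fin as Fin
open import Data.Product using (_×_; _,_; Σ; ∃; ∃-syntax; swap)
open import Data.Product.Properties using (≡-dec)
open import Data.List using (List; []; _∷_; map; concatMap; length; filter; foldr; foldl; scanl; _++_)
open import Data.Bool.ListAction using (all; any)
open import Data.List.Relation.Unary.All using (All)
open import Data.List.Relation.Unary.AllPairs using (AllPairs)
open import Data.List.Membership.Propositional using (_∈_)
open import Data.Rational using (ℚ; _≤ᵇ_; _-_; _*_; _/_) renaming (_≤_ to _≤ℚ_)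
import Data.Integer as ℤ
open import Relation.Nullary using (¬_)
open import Relation.Nullary.Decidable using (⌊_⌋)
open import Relation.Binary.PropositionalEquality using (_≡_; _≢_)

-- Graphs on the vertex set Fin n, given by a list of edges.
-- An edge is written as an ordered pair (u , v); the pairs (u , v) and
-- (v , u) denote the same undirected edge.

Edge : ℕ → Set
Edge n = Fin n × Fin n

_==ᵉ_ : ∀ {n} → Edge n → Edge n → Bool
e ==ᵉ f = ⌊ ≡-dec Fin._≟_ Fin._≟_ e f ⌋

sameEdge : ∀ {n} → Edge n → Edge n → Bool
sameEdge e f = (e ==ᵉ f) ∨ (e ==ᵉ swap f)

edgeOf : ∀ {n} → Edge n → List (Edge n) → Bool
edgeOf e E = any (sameEdge e) E

_==ᵛ_ : ∀ {n} → Fin n → Fin n → Bool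
u ==ᵛ v = ⌊ u Fin.≟ v ⌋

disjointEdges : ∀ {n} → Edge n → Edge n → Bool
disjointEdges (a , b) (c , d) =
  not ((a ==ᵛ c) ∨ (a ==ᵛ d) ∨ (b ==ᵛ c) ∨ (b ==ᵛ d))

isMatchingB : ∀ {n} → List (Edge n) → Bool
isMatchingB [] = true
isMatchingB (e ∷ M) = all (disjointEdges e) M ∧ isMatchingB M

isMatchingOf : ∀ {n} → List (Edge n) → List (Edge n) → Bool
isMatchingOf E M = all (λ e → edgeOf e E) M ∧ isMatchingB M

boolFilter : ∀ {A : Set} → (A → Bool) → List A → List A
boolFilter p [] = []
boolFilter p (x ∷ xs) = if p x then x ∷ boolFilter p xs else boolFilter p xs

sublists : ∀ {A : Set} → List A → List (List A)
sublists [] = [] ∷ []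
sublists (x ∷ xs) = let r = sublists xs in map (x ∷_) r ++ r

μ : ∀ {n} → List (Edge n) → ℕ
μ E = foldr _⊔_ 0 (map length (boolFilter isMatchingB (sublists E)))

IsSimpleGraph : ∀ {n} → List (Edge n) → Set
IsSimpleGraph E =
  All (λ { (u , v) → u ≢ v }) E × AllPairs (λ e f → sameEdge e f ≡ false) E

IsBipartite : ∀ {n} → List (Edge n) → Set
IsBipartite {n} E =
  Σ (Fin n → Bool) (λ side → All (λ { (u , v) → side u ≢ side v }) E)

IsBipartiteGraph : ∀ {n} → List (Edge n) → Set
IsBipartiteGraph E = IsSimpleGraph E × IsBipartite E

-- All orderings of a list (for a list of distinct elements, each of the
-- m! permutations occurs exactly once).

inserts : ∀ {A : Set} → A → List A → List (List A)
inserts x [] = (x ∷ []) ∷ []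
inserts x (y ∷ ys) = (x ∷ y ∷ ys) ∷ map (y ∷_) (inserts x ys)

perms : ∀ {A : Set} → List A → List (List A)
perms [] = [] ∷ []
perms (x ∷ xs) = concatMap (inserts x) (perms xs)

-- Deterministic single-pass streaming algorithms.  The memory contents
-- between two stream elements is a bit string (List Bool).  The algorithm
-- knows n; it has an initial memory state, a transition reading one edge,
-- and an output function producing a list of edges at the end.

record StreamAlg : Set where
  field
    init : (n : ℕ) → List Bool
    step : (n : ℕ) → List Bool → Edge n → List Bool
    out  : (n : ℕ) → List Bool → List (Edge n)

open StreamAlg public

memStates : StreamAlg → (n : ℕ) → List (Edge n) → List (List Bool)
memStates A n σ = scanl (step A n) (init A n) σ

runAlg : StreamAlg → (n : ℕ) → List (Edge n) → List (Edge n)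
runAlg A n σ = out A n (foldl (step A n) (init A n) σ)

memBound : ℕ → ℕ → ℕ → ℕ
memBound c k n = c Data.Nat.* (n + 1) Data.Nat.* ((1 + ⌊log₂ n ⌋) ^ k)

ℕtoℚ : ℕ → ℚ
ℕtoℚ k = ℤ.+ k / 1

success : StreamAlg → (n : ℕ) → List (Edge n) → ℚ → List (Edge n) → Bool
success A n E ε σ =
  let M = runAlg A n σ in
  isMatchingOf E M ∧ (((ℤ.+ 3 / 5) - ε) * ℕtoℚ (μ E) ≤ᵇ ℕtoℚ (length M))

failures : StreamAlg → (n : ℕ) → List (Edge n) → ℚ → ℕ
failures A n E ε = length (boolFilter (λ σ → not (success A n E ε σ)) (perms E))

orderings : ∀ {n} → List (Edge n) → ℕ
orderings E = length (perms E)

IsLittleOOne : (ℕ → ℚ) → Set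
IsLittleOOne ε = ∀ (k : ℕ) → ∃[ N ] (∀ n → N ≤ n → ε n ≤ℚ (ℤ.+ 1 / suc k))

module Submission where

-- Bernstein's random-order algorithm, with constants in place of its ε. A sparsifier H in
-- which deg u + deg v ≤ 14 on every edge is grown by inserting underfull edges, those with
-- deg u + deg v ≤ 12; a potential argument allows O(n) insertions. If a long window of the
-- stream brings no insertion, then, the order being random, only O(n log n) underfull edges
-- are still to come, and all of these are stored in X. Given a vertex cover C of H ∪ X as
-- large as a maximum matching of H ∪ X (Kőnig), every optimal edge of the remaining stream
-- outside C has degree sum at least 13, and counting the edges of H between these edges and
-- C shows that there are at most 7|C|/12 of them. Hence H ∪ X contains a matching of 12/19
-- the size of the late part of a maximum matching, which by a Chernoff bound is at least
-- 19/20 of the whole, and 12/19 · 19/20 = 3/5. Since the number of edges is unknown,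
-- copies for geometrically growing window lengths run in parallel, together with one whose
-- window is empty and which stores a sparse graph completely.

open import Defs
open import Data.Bool using (Bool; true; false; _∧_; _∨_; not; if_then_else_; T)
open import Data.Bool.ListAction using (all; any)
open import Data.Bool.Properties using (∨-zeroʳ; T-≡)
open import Data.Fin as Fin using (Fin; toℕ; fromℕ<)
import Data.Fin.Properties as Fin
import Data.Integer as ℤ
import Data.Integer.Properties as ℤ
open import Data.List using (List; []; _∷_; _++_; length; map; allFin; tabulate; concatMap; foldl; foldr; scanl; take; upTo)
open import Data.List.Extrema.Nat using (argmax; argmax-sel; f[xs]≤f[argmax])
open import Data.List.Membership.Propositional using (_∈_; find; lose)
open import Data.List.Membership.Propositional.Properties using (∈-++⁺ˡ; ∈-++⁺ʳ; ∈-++⁻; ∈-map⁺; ∈-map⁻; ∈-concatMap⁺; ∈-concatMap⁻; ∈-allFin; ∈-upTo⁺; ∈-upTo⁻)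
open import Data.List.Properties using (++-assoc; ++-identityʳ; length-++; length-map; length-tabulate; length-upTo; map-tabulate; map-∘)
open import Data.List.Relation.Binary.Permutation.Propositional as ↭ using (_↭_; ↭-refl; ↭-prep; ↭-swap; ↭-trans; ↭-sym)
open import Data.List.Relation.Binary.Permutation.Propositional.Properties using (All-resp-↭; ∈-resp-↭; ↭-length)
open import Data.List.Relation.Binary.Sublist.Propositional using (_⊆_; []; _∷_; _∷ʳ_; ⊆-refl; ⊆-trans; minimum)
open import Data.List.Relation.Binary.Sublist.Propositional.Properties using (All-resp-⊆; Any-resp-⊆; length-mono-≤; ++⁺ˡ)
open import Data.List.Relation.Unary.All as All using (All; []; _∷_)
import Data.List.Relation.Unary.All.Properties as All
open import Data.List.Relation.Unary.AllPairs using (AllPairs; []; _∷_)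
open import Data.List.Relation.Unary.Any using (here; there)
open import Data.Maybe as Maybe using (Maybe; just; nothing; _>>=_; maybe′)
open import Data.Nat
open import Data.Nat.Binary using (ℕᵇ; 2[1+_]; 1+[2_])
import Data.Nat.Binary as ℕᵇ
import Data.Nat.Binary.Properties as ℕᵇ
open import Data.Nat.Induction using (<-rec)
open import Data.Nat.Logarithm using (⌊log₂_⌋; ⌊log₂⌊n/2⌋⌋≡⌊log₂n⌋∸1; ⌊log₂⌋-mono-≤)
open import Data.Nat.Properties
open import Data.Nat.Tactic.RingSolver using (solve-∀)
open import Data.Product using (_×_; _,_; proj₁; proj₂; ∃; Σ; map₂; swap)
open import Data.Product.Properties using (≡-dec)
open import Data.Rational as ℚ using (ℚ; 0ℚ; toℚᵘ)
import Data.Rational.Properties as ℚ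
open import Data.Rational.Unnormalised as ℚᵘ using (mkℚᵘ; *≤*)
import Data.Rational.Unnormalised.Properties as ℚᵘ
open import Data.Sum using (_⊎_; inj₁; inj₂; [_,_]′)
open import Data.Unit using (tt)
open import Function using (_∘_; id; case_of_)
open import Function.Bundles using (Equivalence)
open import Relation.Binary.PropositionalEquality
open import Relation.Nullary using (Dec; yes; no; contradiction)
open import Relation.Nullary.Decidable using (isYes≗does; dec-true)

-- The thresholds 12 and 14 differ by the 2 that an edge contributes to its own degree sum.
-- Inserting an underfull edge thus raises the sum of squared degrees by at most 2 * 12 + 2 = 26,
-- while deleting an overfull one lowers it by at least 2 * 13 + 2 = 28; the weight 27 lies between.
-- The obstacle in the random part is that H depends on the prefix read so far. After a fixed prefix
-- the rest is again in uniform order, so alarms are estimated at every position and the estimates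
-- are added up. The end of the early part also depends on the stream, but it never lies beyond the
-- fixed `horizon`, so the Chernoff bound is applied to a prefix of fixed length. Probabilities are
-- sums over `perms` with denominators cleared. Every failure is charged to an alarm, in total at
-- most 1/n, or to too many early optimal edges, at most 2^-μ; the latter is at most 1/n because a
-- graph with more edges than the capacity has μ at least `ℒ n`.

private variable
  A B : Set
  n : ℕ

-- Sums and counts over lists

ind : Bool → ℕ
ind true = 1
ind false = 0

∑ : List A → (A → ℕ) → ℕ
∑ [] f = 0
∑ (x ∷ xs) f = f x + ∑ xs f

count : (A → Bool) → List A → ℕ
count p xs = ∑ xs (ind ∘ p)

+-interchange : ∀ a b c d → (a + b) + (c + d) ≡ (a + c) + (b + d)
+-interchange = solve-∀

+-swapˡ : ∀ a b c → a + (b + c) ≡ b + (a + c)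
+-swapˡ = solve-∀

ind≤1 : ∀ b → ind b ≤ 1
ind≤1 true = ≤-refl
ind≤1 false = z≤n

∑-cong : ∀ (xs : List A) {f g : A → ℕ} → (∀ x → f x ≡ g x) → ∑ xs f ≡ ∑ xs g
∑-cong [] e = refl
∑-cong (x ∷ xs) e = cong₂ _+_ (e x) (∑-cong xs e)

∑-mono : ∀ (xs : List A) {f g : A → ℕ} → (∀ x → x ∈ xs → f x ≤ g x) → ∑ xs f ≤ ∑ xs g
∑-mono [] e = z≤n
∑-mono (x ∷ xs) e = +-mono-≤ (e x (here refl)) (∑-mono xs λ y y∈ → e y (there y∈))

∑-++ : ∀ (xs ys : List A) (f : A → ℕ) → ∑ (xs ++ ys) f ≡ ∑ xs f + ∑ ys f
∑-++ [] ys f = refl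
∑-++ (x ∷ xs) ys f = trans (cong (f x +_) (∑-++ xs ys f)) (sym (+-assoc (f x) _ _))

∑-map : ∀ (g : A → B) (xs : List A) (f : B → ℕ) → ∑ (map g xs) f ≡ ∑ xs (f ∘ g)
∑-map g [] f = refl
∑-map g (x ∷ xs) f = cong (f (g x) +_) (∑-map g xs f)

∑-+ : ∀ (xs : List A) (f g : A → ℕ) → ∑ xs (λ x → f x + g x) ≡ ∑ xs f + ∑ xs g
∑-+ [] f g = refl
∑-+ (x ∷ xs) f g = trans (cong (f x + g x +_) (∑-+ xs f g)) (+-interchange (f x) (g x) _ _)

∑-*ˡ : ∀ (xs : List A) k (f : A → ℕ) → ∑ xs (λ x → k * f x) ≡ k * ∑ xs f
∑-*ˡ [] k f = sym (*-zeroʳ k)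
∑-*ˡ (x ∷ xs) k f = trans (cong (k * f x +_) (∑-*ˡ xs k f)) (sym (*-distribˡ-+ k (f x) _))

∑-*ʳ : ∀ (xs : List A) k (f : A → ℕ) → ∑ xs (λ x → f x * k) ≡ ∑ xs f * k
∑-*ʳ xs k f = trans (∑-cong xs λ x → *-comm (f x) k) (trans (∑-*ˡ xs k f) (*-comm k _))

∑-const : ∀ (xs : List A) k → ∑ xs (λ _ → k) ≡ length xs * k
∑-const [] k = refl
∑-const (x ∷ xs) k = cong (k +_) (∑-const xs k)

∑-zero : ∀ (xs : List A) → ∑ xs (λ _ → 0) ≡ 0
∑-zero xs = trans (∑-const xs 0) (*-zeroʳ (length xs))

∑-swap : ∀ (xs : List A) (ys : List B) (f : A → B → ℕ) →
  ∑ xs (λ x → ∑ ys (f x)) ≡ ∑ ys (λ y → ∑ xs (λ x → f x y))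
∑-swap [] ys f = sym (∑-zero ys)
∑-swap (x ∷ xs) ys f =
  trans (cong (∑ ys (f x) +_) (∑-swap xs ys f)) (sym (∑-+ ys (f x) (λ y → ∑ xs (λ z → f z y))))

∑-∈ : ∀ {xs : List A} {x} (f : A → ℕ) → x ∈ xs → f x ≤ ∑ xs f
∑-∈ f (here refl) = m≤m+n _ _
∑-∈ f (there p) = ≤-trans (∑-∈ f p) (m≤n+m _ _)

count≤length : ∀ (p : A → Bool) xs → count p xs ≤ length xs
count≤length p [] = z≤n
count≤length p (x ∷ xs) = +-mono-≤ (ind≤1 (p x)) (count≤length p xs)

length-boolFilter : ∀ (p : A → Bool) xs → length (boolFilter p xs) ≡ count p xs
length-boolFilter p [] = refl
length-boolFilter p (x ∷ xs) with p x
... | true = cong suc (length-boolFilter p xs)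
... | false = length-boolFilter p xs

-- Sums over the vertex set

∑ᵛ : (Fin n → ℕ) → ℕ
∑ᵛ f = ∑ (allFin _) f

∑-tabulate : ∀ {m} (g : Fin m → A) (f : A → ℕ) → ∑ (tabulate g) f ≡ ∑ᵛ (f ∘ g)
∑-tabulate g f = trans (cong (λ l → ∑ l f) (sym (map-tabulate id g))) (∑-map g (allFin _) f)

δ : Fin n → Fin n → ℕ
δ a v = ind (a ==ᵛ v)

==ᵛ-refl : ∀ (a : Fin n) → (a ==ᵛ a) ≡ true
==ᵛ-refl a = trans (isYes≗does (a Fin.≟ a)) (dec-true (a Fin.≟ a) refl)

==ᵛ⇒≡ : ∀ {a b : Fin n} → (a ==ᵛ b) ≡ true → a ≡ b
==ᵛ⇒≡ {a = a} {b} e with a Fin.≟ b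
... | yes p = p

==ᵛ-suc : ∀ (a b : Fin n) → (Fin.suc a ==ᵛ Fin.suc b) ≡ (a ==ᵛ b)
==ᵛ-suc a b = trans (isYes≗does (Fin.suc a Fin.≟ Fin.suc b)) (sym (isYes≗does (a Fin.≟ b)))

δ-refl : ∀ (a : Fin n) → δ a a ≡ 1
δ-refl a = cong ind (==ᵛ-refl a)

∑-δ : ∀ (a : Fin n) (f : Fin n → ℕ) → ∑ᵛ (λ v → δ a v * f v) ≡ f a
∑-δ {suc n} Fin.zero f = begin
  f Fin.zero + 0 + ∑ (tabulate Fin.suc) (λ v → δ Fin.zero v * f v)
    ≡⟨ cong₂ _+_ (+-identityʳ (f Fin.zero)) (∑-tabulate Fin.suc (λ v → δ Fin.zero v * f v)) ⟩
  f Fin.zero + ∑ᵛ {n} (λ v → 0)  ≡⟨ cong (f Fin.zero +_) (∑-zero (allFin n)) ⟩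
  f Fin.zero + 0                 ≡⟨ +-identityʳ _ ⟩
  f Fin.zero ∎
  where open ≡-Reasoning
∑-δ {suc n} (Fin.suc a) f = begin
  ∑ (tabulate Fin.suc) (λ v → δ (Fin.suc a) v * f v)  ≡⟨ ∑-tabulate Fin.suc (λ v → δ (Fin.suc a) v * f v) ⟩
  ∑ᵛ (λ v → δ (Fin.suc a) (Fin.suc v) * f (Fin.suc v))    ≡⟨ ∑-cong (allFin n) (λ v → cong (λ b → ind b * f (Fin.suc v)) (==ᵛ-suc a v)) ⟩
  ∑ᵛ (λ v → δ a v * f (Fin.suc v))                ≡⟨ ∑-δ a (f ∘ Fin.suc) ⟩
  f (Fin.suc a) ∎
  where open ≡-Reasoning

∑ᵛ-const : ∀ k → ∑ᵛ {n} (λ _ → k) ≡ n * k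
∑ᵛ-const {n} k = trans (∑-const (allFin n) k) (cong (_* k) (length-tabulate {n = n} id))

∨-true : ∀ x {y} → x ∨ y ≡ true → x ≡ true ⊎ y ≡ true
∨-true true e = inj₁ refl
∨-true false e = inj₂ e

∨-falseˡ : ∀ x {y} → x ∨ y ≡ false → x ≡ false
∨-falseˡ false e = refl

∨-falseʳ : ∀ x {y} → x ∨ y ≡ false → y ≡ false
∨-falseʳ false e = e

∧-trueˡ : ∀ x {y} → x ∧ y ≡ true → x ≡ true
∧-trueˡ true e = refl

∧-trueʳ : ∀ x {y} → x ∧ y ≡ true → y ≡ true
∧-trueʳ true e = e

not-true : ∀ {x} → not x ≡ true → x ≡ false
not-true {false} e = refl

not-false : ∀ {x} → not x ≡ false → x ≡ true
not-false {true} e = refl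

bool : ∀ b → b ≡ true ⊎ b ≡ false
bool true = inj₁ refl
bool false = inj₂ refl

true≢false : ∀ {b} {C : Set} → b ≡ true → b ≡ false → C
true≢false refl ()

-- Matchings as lists of pairwise disjoint edges

Disjoint : Edge n → Edge n → Set
Disjoint e f = disjointEdges e f ≡ true

Matching : List (Edge n) → Set
Matching = AllPairs Disjoint

Proper : Edge n → Set
Proper (a , b) = a ≢ b

Touches : Fin n → Edge n → Set
Touches x (a , b) = x ≡ a ⊎ x ≡ b

all⇒All : ∀ (p : A → Bool) xs → all p xs ≡ true → All (λ x → p x ≡ true) xs
all⇒All p [] e = []
all⇒All p (x ∷ xs) e = ∧-trueˡ (p x) e ∷ all⇒All p xs (∧-trueʳ (p x) e)

All⇒all : ∀ (p : A → Bool) {xs} → All (λ x → p x ≡ true) xs → all p xs ≡ true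
All⇒all p [] = refl
All⇒all p (e ∷ es) = cong₂ _∧_ e (All⇒all p es)

isMatchingB⇒Matching : ∀ (M : List (Edge n)) → isMatchingB M ≡ true → Matching M
isMatchingB⇒Matching [] e = []
isMatchingB⇒Matching (f ∷ M) e =
  all⇒All (disjointEdges f) M (∧-trueˡ (all (disjointEdges f) M) e)
  ∷ isMatchingB⇒Matching M (∧-trueʳ (all (disjointEdges f) M) e)

Matching⇒isMatchingB : ∀ {M : List (Edge n)} → Matching M → isMatchingB M ≡ true
Matching⇒isMatchingB [] = refl
Matching⇒isMatchingB (d ∷ ds) = cong₂ _∧_ (All⇒all _ d) (Matching⇒isMatchingB ds)

==ᵛ-false : ∀ {a b x : Fin n} → (a ==ᵛ b) ≡ false → x ≡ a → x ≡ b → ∀ {C : Set} → C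
==ᵛ-false {a = a} e refl refl = true≢false (==ᵛ-refl a) e

Disjoint⇒¬Touches : ∀ {e f : Edge n} → Disjoint e f → ∀ {x} → Touches x e → Touches x f → ∀ {C : Set} → C
Disjoint⇒¬Touches {e = a , b} {c , d} p = go
  where
  q : (a ==ᵛ c) ∨ (a ==ᵛ d) ∨ (b ==ᵛ c) ∨ (b ==ᵛ d) ≡ false
  q = not-true p
  q₂ = ∨-falseʳ (a ==ᵛ c) q
  q₃ = ∨-falseʳ (a ==ᵛ d) q₂
  go : ∀ {x} → Touches x (a , b) → Touches x (c , d) → ∀ {C : Set} → C
  go (inj₁ xa) (inj₁ xc) = ==ᵛ-false (∨-falseˡ (a ==ᵛ c) q) xa xc
  go (inj₁ xa) (inj₂ xd) = ==ᵛ-false (∨-falseˡ (a ==ᵛ d) q₂) xa xd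
  go (inj₂ xb) (inj₁ xc) = ==ᵛ-false (∨-falseˡ (b ==ᵛ c) q₃) xb xc
  go (inj₂ xb) (inj₂ xd) = ==ᵛ-false (∨-falseʳ (b ==ᵛ c) q₃) xb xd

¬Disjoint⇒Touches : ∀ (e f : Edge n) → disjointEdges e f ≡ false → ∃ λ x → Touches x e × Touches x f
¬Disjoint⇒Touches (a , b) (c , d) p =
  case ∨-true (a ==ᵛ c) (not-false p) of λ where
    (inj₁ ac) → a , inj₁ refl , inj₁ (==ᵛ⇒≡ ac)
    (inj₂ r) → case ∨-true (a ==ᵛ d) r of λ where
      (inj₁ ad) → a , inj₁ refl , inj₂ (==ᵛ⇒≡ ad)
      (inj₂ s) → case ∨-true (b ==ᵛ c) s of λ where
        (inj₁ bc) → b , inj₂ refl , inj₁ (==ᵛ⇒≡ bc)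
        (inj₂ bd) → b , inj₂ refl , inj₂ (==ᵛ⇒≡ bd)

Disjoint-sym : ∀ {e f : Edge n} → Disjoint e f → Disjoint f e
Disjoint-sym {e = e} {f} p with disjointEdges f e in q
... | true = refl
... | false with ¬Disjoint⇒Touches f e q
...   | x , tf , te = Disjoint⇒¬Touches p te tf

-- Vertex covers and Kőnig's theorem

VSet : ℕ → Set
VSet n = Fin n → Bool

size : VSet n → ℕ
size C = ∑ᵛ (ind ∘ C)

Covers : VSet n → Edge n → Set
Covers C (a , b) = C a ≡ true ⊎ C b ≡ true

Covers? : ∀ (C : VSet n) e → Covers C e ⊎ (∀ {x} → Touches x e → C x ≡ false)
Covers? C (a , b) with C a in p | C b in q
... | true | _ = inj₁ (inj₁ refl)
... | false | true = inj₁ (inj₂ refl)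
... | false | false = inj₂ λ { (inj₁ refl) → p ; (inj₂ refl) → q }

leftEnds : List (Edge n) → VSet n
leftEnds [] v = false
leftEnds ((a , b) ∷ E) v = (a ==ᵛ v) ∨ leftEnds E v

ind-∨ : ∀ x y → ind (x ∨ y) ≤ ind x + ind y
ind-∨ true y = s≤s z≤n
ind-∨ false y = ≤-refl

∑ᵛ-δ : ∀ (a : Fin n) → ∑ᵛ (δ a) ≡ 1
∑ᵛ-δ a = trans (∑-cong (allFin _) λ v → sym (*-identityʳ (δ a v))) (∑-δ a (λ _ → 1))

size-leftEnds : ∀ (E : List (Edge n)) → size (leftEnds E) ≤ length E
size-leftEnds {n} [] = ≤-reflexive (∑-zero (allFin n))
size-leftEnds ((a , b) ∷ E) = begin
  size (leftEnds ((a , b) ∷ E))            ≤⟨ ∑-mono (allFin _) (λ v _ → ind-∨ (a ==ᵛ v) (leftEnds E v)) ⟩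
  ∑ᵛ (λ v → δ a v + ind (leftEnds E v))    ≡⟨ ∑-+ (allFin _) (δ a) _ ⟩
  ∑ᵛ (δ a) + size (leftEnds E)             ≤⟨ +-mono-≤ (≤-reflexive (∑ᵛ-δ a)) (size-leftEnds E) ⟩
  suc (length E) ∎
  where open ≤-Reasoning

leftEnds-covers : ∀ (E : List (Edge n)) → All (Covers (leftEnds E)) E
leftEnds-covers [] = []
leftEnds-covers ((a , b) ∷ E) =
  inj₁ (cong (_∨ leftEnds E a) (==ᵛ-refl a)) ∷ All.map (λ {e} → weaken {e}) (leftEnds-covers E)
  where
  weaken : ∀ {e} → Covers (leftEnds E) e → Covers (leftEnds ((a , b) ∷ E)) e
  weaken {c , d} (inj₁ p) = inj₁ (trans (cong ((a ==ᵛ c) ∨_) p) (∨-zeroʳ _))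
  weaken {c , d} (inj₂ p) = inj₂ (trans (cong ((a ==ᵛ d) ∨_) p) (∨-zeroʳ _))

record Conflict (E : List (Edge n)) : Set where
  field
    e f : Edge n
    x : Fin n
    x∈e : Touches x e
    x∈f : Touches x f
    E-e E-f : List (Edge n)
    sub-e : E-e ⊆ E
    sub-f : E-f ⊆ E
    len-e : suc (length E-e) ≡ length E
    len-f : suc (length E-f) ≡ length E
    f∈E-e : f ∈ E-e
    e∈E-f : e ∈ E-f
    split-e : ∀ {g} → g ∈ E → g ≡ e ⊎ g ∈ E-e
    split-f : ∀ {g} → g ∈ E → g ≡ f ⊎ g ∈ E-f

record Deletion (e : Edge n) (E : List (Edge n)) : Set where
  field
    rest : List (Edge n)
    sub : rest ⊆ E
    len : suc (length rest) ≡ length E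
    sum : ∀ (f : Edge _ → ℕ) → ∑ E f ≡ f e + ∑ rest f
    split : ∀ {g} → g ∈ E → g ≡ e ⊎ g ∈ rest

delete : ∀ {e} {E : List (Edge n)} → e ∈ E → Deletion e E
delete {E = _ ∷ E} (here refl) = record
  { rest = E ; sub = _ ∷ʳ ⊆-refl ; len = refl ; sum = λ f → refl ; split = λ { (here p) → inj₁ p ; (there p) → inj₂ p } }
delete {e = e} {E = g ∷ E} (there p) = record
  { rest = g ∷ rest ; sub = refl ∷ sub ; len = cong suc len
  ; sum = λ f → trans (cong (f g +_) (sum f)) (+-swapˡ (f g) (f e) (∑ rest f))
  ; split = λ { (here q) → inj₂ (here q) ; (there q) → [ inj₁ , inj₂ ∘ there ]′ (split q) } }
  where open Deletion (delete p)

disjointFromAll? : ∀ (e : Edge n) E → All (Disjoint e) E ⊎ ∃ λ f → f ∈ E × disjointEdges e f ≡ false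
disjointFromAll? e [] = inj₁ []
disjointFromAll? e (f ∷ E) with disjointEdges e f in p | disjointFromAll? e E
... | false | _ = inj₂ (f , here refl , p)
... | true | inj₁ d = inj₁ (p ∷ d)
... | true | inj₂ (g , g∈ , q) = inj₂ (g , there g∈ , q)

matching? : ∀ (E : List (Edge n)) → Matching E ⊎ Conflict E
matching? [] = inj₁ []
matching? (g ∷ E) with matching? E
... | inj₂ c = inj₂ (record
    { e = e ; f = f ; x = x ; x∈e = x∈e ; x∈f = x∈f ; E-e = g ∷ E-e ; E-f = g ∷ E-f
    ; sub-e = refl ∷ sub-e ; sub-f = refl ∷ sub-f ; len-e = cong suc len-e ; len-f = cong suc len-f
    ; f∈E-e = there f∈E-e ; e∈E-f = there e∈E-f
    ; split-e = λ { (here p) → inj₂ (here p) ; (there p) → [ inj₁ , inj₂ ∘ there ]′ (split-e p) }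
    ; split-f = λ { (here p) → inj₂ (here p) ; (there p) → [ inj₁ , inj₂ ∘ there ]′ (split-f p) } })
  where open Conflict c
... | inj₁ m with disjointFromAll? g E
...   | inj₁ d = inj₁ (d ∷ m)
...   | inj₂ (f , f∈E , p) with ¬Disjoint⇒Touches g f p
...     | x , x∈g , x∈f = inj₂ (record
    { e = g ; f = f ; x = x ; x∈e = x∈g ; x∈f = x∈f ; E-e = E ; E-f = g ∷ rest
    ; sub-e = g ∷ʳ ⊆-refl ; sub-f = refl ∷ sub ; len-e = refl ; len-f = cong suc len
    ; f∈E-e = f∈E ; e∈E-f = here refl
    ; split-e = λ { (here q) → inj₁ q ; (there q) → inj₂ q }
    ; split-f = λ { (here q) → inj₂ (here q) ; (there q) → [ inj₁ , inj₂ ∘ there ]′ (split q) } })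
  where open Deletion (delete f∈E)

Separates : (Fin n → Bool) → Edge n → Set
Separates s (a , b) = s a ≢ s b

-- Lovász's uncrossing of two covers C and D that both miss x: the vertices in both,
-- together with one colour class of the vertices in C ∪ D ∪ {x}.
mix : VSet n → VSet n → Fin n → VSet n → VSet n
mix C D x s v = (C v ∧ D v) ∨ ((C v ∨ D v ∨ (x ==ᵛ v)) ∧ s v)

module _ (C D : VSet n) (x : Fin n) (Cx : C x ≡ false) (Dx : D x ≡ false) (s : Fin n → Bool) where

  -- A vertex of both covers lies in both mixes, a vertex of exactly one cover in one of them. The
  -- extra 1 is x, which is in neither cover but joins one mix.
  size-mix : size (mix C D x s) + size (mix C D x (not ∘ s)) ≡ size C + size D + 1
  size-mix = begin
    size (mix C D x s) + size (mix C D x (not ∘ s))              ≡⟨ ∑-+ (allFin _) (ind ∘ mix C D x s) (ind ∘ mix C D x (not ∘ s)) ⟨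
    ∑ᵛ (λ v → ind (mix C D x s v) + ind (mix C D x (not ∘ s) v)) ≡⟨ ∑-cong (allFin _) (λ v → pointwise (C v) (D v) (x ==ᵛ v) (s v) (missed v)) ⟩
    ∑ᵛ (λ v → ind (C v) + ind (D v) + δ x v)                     ≡⟨ ∑-+ (allFin _) (λ v → ind (C v) + ind (D v)) (δ x) ⟩
    ∑ᵛ (λ v → ind (C v) + ind (D v)) + ∑ᵛ (δ x)                  ≡⟨ cong₂ _+_ (∑-+ (allFin _) (ind ∘ C) (ind ∘ D)) (∑ᵛ-δ x) ⟩
    size C + size D + 1 ∎
    where
    open ≡-Reasoning
    missed : ∀ v → (x ==ᵛ v) ≡ true → C v ≡ false × D v ≡ false
    missed v p = subst (λ w → C w ≡ false) (==ᵛ⇒≡ p) Cx , subst (λ w → D w ≡ false) (==ᵛ⇒≡ p) Dx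
    pointwise : ∀ c d y t → (y ≡ true → c ≡ false × d ≡ false) →
      ind ((c ∧ d) ∨ ((c ∨ d ∨ y) ∧ t)) + ind ((c ∧ d) ∨ ((c ∨ d ∨ y) ∧ not t)) ≡ ind c + ind d + ind y
    pointwise c d true t m with m refl
    pointwise false false true true m | _ = refl
    pointwise false false true false m | _ = refl
    pointwise true true false t m = refl
    pointwise true false false true m = refl
    pointwise true false false false m = refl
    pointwise false true false true m = refl
    pointwise false true false false m = refl
    pointwise false false false true m = refl
    pointwise false false false false m = refl

  private
    U : VSet _
    U v = C v ∨ D v ∨ (x ==ᵛ v)

    C⇒U : ∀ {v} → C v ≡ true → U v ≡ true
    C⇒U {v} p = cong (_∨ (D v ∨ (x ==ᵛ v))) p

    D⇒U : ∀ {v} → D v ≡ true → U v ≡ true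
    D⇒U {v} p = trans (cong (λ b → C v ∨ b ∨ (x ==ᵛ v)) p) (∨-zeroʳ (C v))

    x⇒U : U x ≡ true
    x⇒U = trans (cong (λ b → C x ∨ D x ∨ b) (==ᵛ-refl x)) (trans (cong (C x ∨_) (∨-zeroʳ (D x))) (∨-zeroʳ (C x)))

    both : ∀ {v} → C v ≡ true → D v ≡ true → mix C D x s v ≡ true
    both {v} p q = cong (_∨ (U v ∧ s v)) (cong₂ _∧_ p q)

    union : ∀ {v} → U v ≡ true → s v ≡ true → mix C D x s v ≡ true
    union {v} p q = trans (cong ((C v ∧ D v) ∨_) (cong₂ _∧_ p q)) (∨-zeroʳ (C v ∧ D v))

    unionEdge : ∀ {g} → Separates s g → U (proj₁ g) ≡ true → U (proj₂ g) ≡ true → Covers (mix C D x s) g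
    unionEdge {a , b} sep p q = case bool (s a) , bool (s b) of λ where
      (inj₁ sa , _) → inj₁ (union p sa)
      (inj₂ _ , inj₁ sb) → inj₂ (union q sb)
      (inj₂ sa , inj₂ sb) → contradiction (trans sa (sym sb)) sep

  -- If both covers use the same end of the edge, that end belongs to the mix. Otherwise both ends
  -- lie in the union, and one of them has the chosen colour.
  mix-covers : ∀ {g} → Separates s g → Covers C g → Covers D g → Covers (mix C D x s) g
  mix-covers sep (inj₁ p) (inj₁ q) = inj₁ (both p q)
  mix-covers sep (inj₁ p) (inj₂ q) = unionEdge sep (C⇒U p) (D⇒U q)
  mix-covers sep (inj₂ p) (inj₁ q) = unionEdge sep (D⇒U q) (C⇒U p)
  mix-covers sep (inj₂ p) (inj₂ q) = inj₂ (both p q)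

  -- For the edge whose deletion led to D: only C is known to cover it. Its end x is not in C, so
  -- its other end is, and adding x puts both ends into the union.
  mix-coversˡ : ∀ {g} → Separates s g → Touches x g → Covers C g → Covers (mix C D x s) g
  mix-coversˡ sep (inj₁ refl) (inj₁ p) = true≢false p Cx
  mix-coversˡ sep (inj₁ refl) (inj₂ p) = unionEdge sep x⇒U (C⇒U p)
  mix-coversˡ sep (inj₂ refl) (inj₁ p) = unionEdge sep (C⇒U p) x⇒U
  mix-coversˡ sep (inj₂ refl) (inj₂ p) = true≢false p Cx

  mix-coversʳ : ∀ {g} → Separates s g → Touches x g → Covers D g → Covers (mix C D x s) g
  mix-coversʳ sep (inj₁ refl) (inj₁ p) = true≢false p Dx
  mix-coversʳ sep (inj₁ refl) (inj₂ p) = unionEdge sep x⇒U (D⇒U p)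
  mix-coversʳ sep (inj₂ refl) (inj₁ p) = unionEdge sep (D⇒U p) x⇒U
  mix-coversʳ sep (inj₂ refl) (inj₂ p) = true≢false p Dx

SmallCover LargeMatching : ℕ → List (Edge n) → Set
SmallCover {n} k E = Σ (VSet n) λ C → size C ≤ k × All (Covers C) E
LargeMatching k E = ∃ λ M → M ⊆ E × Matching M × k < length M

half-≤ : ∀ a b k → a + b ≤ k + k + 1 → a ≤ k ⊎ b ≤ k
half-≤ a b k p with a ≤? k | b ≤? k
... | yes q | _ = inj₁ q
... | no _ | yes q = inj₂ q
... | no q | no r = contradiction p (<⇒≱ (begin-strict
  k + k + 1     <⟨ n<1+n _ ⟩
  suc (k + k + 1) ≡⟨ lem k ⟩
  suc k + suc k ≤⟨ +-mono-≤ (≰⇒> q) (≰⇒> r) ⟩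
  a + b ∎))
  where
  open ≤-Reasoning
  lem : ∀ k → suc (k + k + 1) ≡ suc k + suc k
  lem = solve-∀

-- Induction on the number of edges. At most k edges are covered by their left ends; more than k
-- edges are the desired matching unless two of them, e and f, meet at some x. Covers C of E - e and
-- D of E - f settle the case unless C misses e and D misses f. Then both miss x, and the two mixes
-- have at most 2k + 1 vertices together, so one has at most k.
kőnig : ∀ (s : Fin n → Bool) k (E : List (Edge n)) → All (Separates s) E → SmallCover k E ⊎ LargeMatching k E
kőnig {n} s k E₀ = go (length E₀) E₀ ≤-refl
  where
  go : ∀ l (E : List (Edge n)) → length E ≤ l → All (Separates s) E → SmallCover k E ⊎ LargeMatching k E
  go l E E≤l sep with length E ≤? k
  ... | yes E≤k = inj₁ (leftEnds E , ≤-trans (size-leftEnds E) E≤k , leftEnds-covers E)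
  ... | no E≰k with matching? E
  ...   | inj₁ m = inj₂ (E , ⊆-refl , m , ≰⇒> E≰k)
  go zero E E≤l sep | no E≰k | inj₂ c = contradiction (≤-trans E≤l z≤n) E≰k
  go (suc l) E E≤l sep | no E≰k | inj₂ c
    with go l E-e (s≤s⁻¹ (subst (_≤ suc l) (sym len-e) E≤l)) (All-resp-⊆ sub-e sep)
       | go l E-f (s≤s⁻¹ (subst (_≤ suc l) (sym len-f) E≤l)) (All-resp-⊆ sub-f sep)
    where open Conflict c
  ... | inj₂ (M , M⊆ , m) | _ = inj₂ (M , ⊆-trans M⊆ (Conflict.sub-e c) , m)
  ... | inj₁ _ | inj₂ (M , M⊆ , m) = inj₂ (M , ⊆-trans M⊆ (Conflict.sub-f c) , m)
  ... | inj₁ (C , C≤k , C-cov) | inj₁ (D , D≤k , D-cov) with Covers? C (Conflict.e c) | Covers? D (Conflict.f c)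
  ...   | inj₁ Ce | _ = inj₁ (C , C≤k , All.tabulate λ g∈ → [ (λ { refl → Ce }) , All.lookup C-cov ]′ (Conflict.split-e c g∈))
  ...   | inj₂ _ | inj₁ Df = inj₁ (D , D≤k , All.tabulate λ g∈ → [ (λ { refl → Df }) , All.lookup D-cov ]′ (Conflict.split-f c g∈))
  ...   | inj₂ ¬Ce | inj₂ ¬Df = inj₁ (
    case half-≤ (size (mix C D x s)) (size (mix C D x (not ∘ s))) k
           (≤-trans (≤-reflexive (size-mix C D x Cx Dx s)) (+-monoˡ-≤ 1 (+-mono-≤ C≤k D≤k))) of λ where
      (inj₁ p) → mix C D x s , p , covers s sep
      (inj₂ p) → mix C D x (not ∘ s) , p , covers (not ∘ s) (All.map (λ ne eq → ne (not-injective′ eq)) sep))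
    where
    open Conflict c
    Cx = ¬Ce x∈e
    Dx = ¬Df x∈f
    not-injective′ : ∀ {a b} → not a ≡ not b → a ≡ b
    not-injective′ {true} {true} _ = refl
    not-injective′ {false} {false} _ = refl
    covers : ∀ t → All (Separates t) E → All (Covers (mix C D x t)) E
    covers t sept = All.tabulate λ {g} g∈ → case split-e g∈ , split-f g∈ of λ where
      (inj₁ refl , _) → mix-coversʳ C D x Cx Dx t (All.lookup sept g∈) x∈e (All.lookup D-cov e∈E-f)
      (inj₂ _ , inj₁ refl) → mix-coversˡ C D x Cx Dx t (All.lookup sept g∈) x∈f (All.lookup C-cov f∈E-e)
      (inj₂ p , inj₂ q) → mix-covers C D x Cx Dx t (All.lookup sept g∈) (All.lookup C-cov p) (All.lookup D-cov q)

-- Degrees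

inc : Edge n → Fin n → ℕ
inc (a , b) v = δ a v + δ b v

deg : List (Edge n) → Fin n → ℕ
deg E v = ∑ E λ e → inc e v

ends : (Fin n → ℕ) → Edge n → ℕ
ends f (a , b) = f a + f b

∑-inc : ∀ (e : Edge n) f → ∑ᵛ (λ v → inc e v * f v) ≡ ends f e
∑-inc {n} (a , b) f = begin
  ∑ᵛ (λ v → (δ a v + δ b v) * f v)      ≡⟨ ∑-cong (allFin n) (λ v → *-distribʳ-+ (f v) (δ a v) (δ b v)) ⟩
  ∑ᵛ (λ v → δ a v * f v + δ b v * f v)  ≡⟨ ∑-+ (allFin n) (λ v → δ a v * f v) (λ v → δ b v * f v) ⟩
  ∑ᵛ (λ v → δ a v * f v) + ∑ᵛ (λ v → δ b v * f v) ≡⟨ cong₂ _+_ (∑-δ a f) (∑-δ b f) ⟩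
  f a + f b ∎
  where open ≡-Reasoning

-- Double counting of the pairs of an edge and one of its ends. The weight later singles out the
-- edges between the heavy edges and the cover.
∑-weighted-ends : ∀ (E : List (Edge n)) (w : Edge n → ℕ) f →
  ∑ E (λ e → w e * ends f e) ≡ ∑ᵛ (λ v → ∑ E (λ e → w e * inc e v) * f v)
∑-weighted-ends {n} E w f = begin
  ∑ E (λ e → w e * ends f e)
    ≡⟨ ∑-cong E (λ e → cong (w e *_) (sym (∑-inc e f))) ⟩
  ∑ E (λ e → w e * ∑ᵛ (λ v → inc e v * f v))
    ≡⟨ ∑-cong E (λ e → sym (∑-*ˡ (allFin n) (w e) (λ v → inc e v * f v))) ⟩
  ∑ E (λ e → ∑ᵛ (λ v → w e * (inc e v * f v)))
    ≡⟨ ∑-swap E (allFin n) (λ e v → w e * (inc e v * f v)) ⟩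
  ∑ᵛ (λ v → ∑ E (λ e → w e * (inc e v * f v)))
    ≡⟨ ∑-cong (allFin n) (λ v → ∑-cong E λ e → sym (*-assoc (w e) (inc e v) (f v))) ⟩
  ∑ᵛ (λ v → ∑ E (λ e → w e * inc e v * f v))
    ≡⟨ ∑-cong (allFin n) (λ v → ∑-*ʳ E (f v) (λ e → w e * inc e v)) ⟩
  ∑ᵛ (λ v → ∑ E (λ e → w e * inc e v) * f v) ∎
  where open ≡-Reasoning

∑-ends : ∀ (E : List (Edge n)) f → ∑ E (ends f) ≡ ∑ᵛ (λ v → deg E v * f v)
∑-ends {n} E f = begin
  ∑ E (ends f)                               ≡⟨ ∑-cong E (λ e → sym (*-identityˡ (ends f e))) ⟩
  ∑ E (λ e → 1 * ends f e)                   ≡⟨ ∑-weighted-ends E (λ _ → 1) f ⟩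
  ∑ᵛ (λ v → ∑ E (λ e → 1 * inc e v) * f v)
    ≡⟨ ∑-cong (allFin n) (λ v → cong (_* f v) (∑-cong E λ e → *-identityˡ (inc e v))) ⟩
  ∑ᵛ (λ v → deg E v * f v) ∎
  where open ≡-Reasoning

∑ᵛ-deg : ∀ (E : List (Edge n)) → ∑ᵛ (deg E) ≡ length E * 2
∑ᵛ-deg {n} E = begin
  ∑ᵛ (deg E)                 ≡⟨ ∑-cong (allFin n) (λ v → sym (*-identityʳ (deg E v))) ⟩
  ∑ᵛ (λ v → deg E v * 1)     ≡⟨ ∑-ends E (λ _ → 1) ⟨
  ∑ E (λ _ → 2)              ≡⟨ ∑-const E 2 ⟩
  length E * 2 ∎
  where open ≡-Reasoning

inc≢0⇒Touches : ∀ (e : Edge n) v → inc e v ≡ 0 ⊎ Touches v e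
inc≢0⇒Touches (a , b) v with a Fin.≟ v | b Fin.≟ v
... | yes p | _ = inj₂ (inj₁ (sym p))
... | no _ | yes q = inj₂ (inj₂ (sym q))
... | no _ | no _ = inj₁ refl

inc≤1 : ∀ (e : Edge n) v → Proper e → inc e v ≤ 1
inc≤1 (a , b) v ne with a Fin.≟ v | b Fin.≟ v
... | yes p | yes q = contradiction (trans p (sym q)) ne
... | yes p | no _ = ≤-refl
... | no _ | yes _ = ≤-refl
... | no _ | no _ = z≤n

deg≡0 : ∀ (E : List (Edge n)) v → (∀ {e} → e ∈ E → Touches v e → inc e v ≡ 0) → deg E v ≡ 0
deg≡0 [] v h = refl
deg≡0 (e ∷ E) v h = cong₂ _+_ ([ id , h (here refl) ]′ (inc≢0⇒Touches e v)) (deg≡0 E v (h ∘ there))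

deg-matching≤1 : ∀ {M : List (Edge n)} v → All Proper M → Matching M → deg M v ≤ 1
deg-matching≤1 v [] [] = z≤n
deg-matching≤1 {M = e ∷ M} v (p ∷ ps) (d ∷ ds) with inc≢0⇒Touches e v
... | inj₁ z = subst (λ i → i + deg M v ≤ 1) (sym z) (deg-matching≤1 v ps ds)
... | inj₂ t = begin
  inc e v + deg M v ≡⟨ cong (inc e v +_) (deg≡0 M v λ f∈ t′ → Disjoint⇒¬Touches (All.lookup d f∈) t t′) ⟩
  inc e v + 0       ≡⟨ +-identityʳ _ ⟩
  inc e v           ≤⟨ inc≤1 e v p ⟩
  1 ∎
  where open ≤-Reasoning

Covers⇒ends : ∀ (C : VSet n) {e} → Covers C e → 1 ≤ ends (ind ∘ C) e
Covers⇒ends C (inj₁ p) = ≤-trans (≤-reflexive (cong ind (sym p))) (m≤m+n _ _)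
Covers⇒ends C (inj₂ p) = ≤-trans (≤-reflexive (cong ind (sym p))) (m≤n+m _ _)

-- Each edge is charged to an end in C, and a vertex of C is charged at most k times. With k = 1
-- this bounds a matching by a cover, with k = n a simple graph.
covered-length : ∀ (C : VSet n) {E} k → All (Covers C) E → (∀ v → deg E v ≤ k) → length E ≤ size C * k
covered-length {n} C {E} k cov deg≤ = begin
  length E                          ≡⟨ *-identityʳ _ ⟨
  length E * 1                      ≡⟨ ∑-const E 1 ⟨
  ∑ E (λ _ → 1)                     ≤⟨ ∑-mono E (λ e e∈ → Covers⇒ends C (All.lookup cov e∈)) ⟩
  ∑ E (ends (ind ∘ C))              ≡⟨ ∑-ends E (ind ∘ C) ⟩
  ∑ᵛ (λ v → deg E v * ind (C v))    ≤⟨ ∑-mono (allFin n) (λ v _ → *-monoˡ-≤ (ind (C v)) (deg≤ v)) ⟩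
  ∑ᵛ (λ v → k * ind (C v))          ≡⟨ ∑-*ˡ (allFin n) k (ind ∘ C) ⟩
  k * size C                        ≡⟨ *-comm k _ ⟩
  size C * k ∎
  where open ≤-Reasoning

-- Simple graphs

SimplyDistinct : List (Edge n) → Set
SimplyDistinct = AllPairs λ e f → sameEdge e f ≡ false

==ᵉ-refl : ∀ (e : Edge n) → (e ==ᵉ e) ≡ true
==ᵉ-refl e = trans (isYes≗does (≡-dec Fin._≟_ Fin._≟_ e e)) (dec-true (≡-dec Fin._≟_ Fin._≟_ e e) refl)

==ᵉ⇒≡ : ∀ {e f : Edge n} → (e ==ᵉ f) ≡ true → e ≡ f
==ᵉ⇒≡ {e = e} {f} p with ≡-dec Fin._≟_ Fin._≟_ e f
... | yes q = q

sameEdge⇒ : ∀ (e f : Edge n) → sameEdge e f ≡ true → e ≡ f ⊎ e ≡ swap f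
sameEdge⇒ e f p = [ inj₁ ∘ ==ᵉ⇒≡ , inj₂ ∘ ==ᵉ⇒≡ ]′ (∨-true (e ==ᵉ f) p)

sameEdge-refl : ∀ (e : Edge n) → sameEdge e e ≡ true
sameEdge-refl e = cong (_∨ (e ==ᵉ swap e)) (==ᵉ-refl e)

sameEdge-swap : ∀ (e : Edge n) → sameEdge e (swap e) ≡ true
sameEdge-swap e = trans (cong ((e ==ᵉ swap e) ∨_) (==ᵉ-refl e)) (∨-zeroʳ _)

sameEdge-trans : ∀ (e f g : Edge n) → sameEdge e g ≡ true → sameEdge f g ≡ true → sameEdge e f ≡ true
sameEdge-trans e f g p q with sameEdge⇒ e g p | sameEdge⇒ f g q
... | inj₁ refl | inj₁ refl = sameEdge-refl e
... | inj₁ refl | inj₂ refl = sameEdge-swap e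
... | inj₂ refl | inj₁ refl = sameEdge-swap e
... | inj₂ refl | inj₂ refl = sameEdge-refl e

count-sameEdge≤1 : ∀ {E : List (Edge n)} g → SimplyDistinct E → count (λ e → sameEdge e g) E ≤ 1
count-sameEdge≤1 g [] = z≤n
count-sameEdge≤1 {E = e ∷ E} g (d ∷ ds) with sameEdge e g in p
... | false = count-sameEdge≤1 g ds
... | true = ≤-reflexive (cong suc (trans (∑-zero′ E λ f f∈ → other f f∈) refl))
  where
  ∑-zero′ : ∀ (xs : List (Edge _)) {f} → (∀ x → x ∈ xs → f x ≡ 0) → ∑ xs f ≡ 0
  ∑-zero′ xs h = n≤0⇒n≡0 (≤-trans (∑-mono xs (λ x x∈ → ≤-reflexive (h x x∈))) (≤-reflexive (∑-zero xs)))
  other : ∀ f → f ∈ E → ind (sameEdge f g) ≡ 0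
  other f f∈ with sameEdge f g in q
  ... | false = refl
  ... | true = true≢false (sameEdge-trans e f g p q) (All.lookup d f∈)

inc≤neighbours : ∀ (e : Edge n) v → Proper e → inc e v ≤ ∑ᵛ (λ u → ind (sameEdge e (v , u)))
inc≤neighbours {n} e@(a , b) v p with inc≢0⇒Touches e v
... | inj₁ z = ≤-trans (≤-reflexive z) z≤n
... | inj₂ (inj₁ refl) = ≤-trans (inc≤1 e v p) (≤-trans (≤-reflexive (cong ind (sym (sameEdge-refl e))))
  (∑-∈ (λ u → ind (sameEdge e (v , u))) (∈-allFin b)))
... | inj₂ (inj₂ refl) = ≤-trans (inc≤1 e v p) (≤-trans (≤-reflexive (cong ind (sym (sameEdge-swap e))))
  (∑-∈ (λ u → ind (sameEdge e (v , u))) (∈-allFin a)))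

simple⇒Proper : ∀ {E : List (Edge n)} → IsSimpleGraph E → All Proper E
simple⇒Proper (proper , _) = All.map (λ { {_ , _} p → p }) proper

deg≤n : ∀ {E : List (Edge n)} → IsSimpleGraph E → ∀ v → deg E v ≤ n
deg≤n {n} {E} simple@(_ , distinct) v = begin
  deg E v                                             ≤⟨ ∑-mono E (λ e e∈ → inc≤neighbours e v (All.lookup (simple⇒Proper simple) e∈)) ⟩
  ∑ E (λ e → ∑ᵛ (λ u → ind (sameEdge e (v , u))))     ≡⟨ ∑-swap E (allFin n) _ ⟩
  ∑ᵛ (λ u → count (λ e → sameEdge e (v , u)) E)       ≤⟨ ∑-mono (allFin n) (λ u _ → count-sameEdge≤1 (v , u) distinct) ⟩
  ∑ᵛ {n} (λ _ → 1)                                    ≡⟨ ∑ᵛ-const {n} 1 ⟩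
  n * 1                                               ≡⟨ *-identityʳ n ⟩
  n ∎
  where open ≤-Reasoning

-- Heavy edges outside a cover of the sparsifier

2ab≤a²+b² : ∀ a b → 2 * (a * b) ≤ a * a + b * b
2ab≤a²+b² a b with ≤-total a b
... | inj₁ a≤b with m≤n⇒∃[o]m+o≡n a≤b
...   | k , refl = ≤-trans (m≤m+n _ (k * k)) (≤-reflexive (eq a k))
  where
  eq : ∀ a k → 2 * (a * (a + k)) + k * k ≡ a * a + (a + k) * (a + k)
  eq = solve-∀
2ab≤a²+b² a b | inj₂ b≤a with m≤n⇒∃[o]m+o≡n b≤a
...   | k , refl = ≤-trans (m≤m+n _ (k * k)) (≤-reflexive (eq b k))
  where
  eq : ∀ b k → 2 * ((b + k) * b) + k * k ≡ (b + k) * (b + k) + b * b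
  eq = solve-∀

Avoids : VSet n → Edge n → Set
Avoids C e = ∀ {x} → Touches x e → C x ≡ false

-- The weight `w` of an edge of H is the number of its ends in V(N). As C covers the edge and misses
-- V(N), it is 0 or 1, so W counts the edges of H between V(N) and C, and `g` is the degree in this
-- subgraph. The support of `g` has at most 2t + q vertices; Cauchy-Schwarz, in linearised form, and
-- ∑ g d ≤ 14 W bound W from above, while heaviness gives W ≥ 13 t.
module _ (C : VSet n) (H N : List (Edge n))
  (H-covered : All (Covers C) H) (H-bounded : All (λ e → ends (deg H) e ≤ 14) H)
  (N-proper : All Proper N) (N-matching : Matching N) (N-avoids : All (Avoids C) N)
  (N-heavy : All (λ e → 13 ≤ ends (deg H) e) N) where

  private
    s c d g : Fin n → ℕ
    s = deg N
    c = ind ∘ C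
    d = deg H
    w : Edge n → ℕ
    w = ends s
    g v = ∑ H λ e → w e * inc e v
    W t q : ℕ
    W = ∑ H w
    t = length N
    q = size C

    s≤1 : ∀ v → s v ≤ 1
    s≤1 v = deg-matching≤1 v N-proper N-matching

    s-avoids : ∀ {v} → C v ≡ true → s v ≡ 0
    s-avoids {v} p = deg≡0 N v λ e∈ v∈e → true≢false p (All.lookup N-avoids e∈ v∈e)

    other : ∀ {a b} → C a ≡ true ⊎ C b ≡ true → s b ≤ c a
    other {a} {b} (inj₁ p) = ≤-trans (s≤1 b) (≤-reflexive (cong ind (sym p)))
    other {a} {b} (inj₂ p) = ≤-trans (≤-reflexive (s-avoids p)) z≤n

    w≤1 : ∀ {e} → Covers C e → w e ≤ 1
    w≤1 {a , b} (inj₁ p) = +-mono-≤ (≤-reflexive (s-avoids p)) (s≤1 b)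
    w≤1 {a , b} (inj₂ p) = ≤-trans (≤-reflexive (cong (s a +_) (s-avoids p))) (≤-trans (≤-reflexive (+-identityʳ _)) (s≤1 a))

    w-inc : ∀ {e} v → Covers C e → w e * inc e v ≤ inc e v * (s v + c v)
    w-inc {e@(a , b)} v cov with inc≢0⇒Touches e v
    ... | inj₁ z = ≤-trans (≤-reflexive (trans (cong (w e *_) z) (*-zeroʳ (w e)))) z≤n
    ... | inj₂ (inj₁ refl) = ≤-trans (≤-reflexive (*-comm (w e) (inc e a))) (*-monoʳ-≤ (inc e a) (+-monoʳ-≤ (s a) (other cov)))
    ... | inj₂ (inj₂ refl) = ≤-trans (≤-reflexive (*-comm (w e) (inc e b)))
      (*-monoʳ-≤ (inc e b) (≤-trans (≤-reflexive (+-comm (s a) (s b))) (+-monoʳ-≤ (s b) (other (swap-⊎ cov)))))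
      where
      swap-⊎ : ∀ {X Y : Set} → X ⊎ Y → Y ⊎ X
      swap-⊎ = [ inj₂ , inj₁ ]′

    g≤d : ∀ v → g v ≤ d v
    g≤d v = ∑-mono H λ e e∈ → ≤-trans (*-monoˡ-≤ (inc e v) (w≤1 (All.lookup H-covered e∈))) (≤-reflexive (*-identityˡ _))

    g≤d[s+c] : ∀ v → g v ≤ d v * (s v + c v)
    g≤d[s+c] v = ≤-trans (∑-mono H λ e e∈ → w-inc v (All.lookup H-covered e∈)) (≤-reflexive (∑-*ʳ H (s v + c v) (λ e → inc e v)))

    -- 14 g ≤ g² + 49 is tight at g = 7, half the degree bound.
    pointwise : ∀ v → 14 * g v ≤ g v * d v + 49 * (s v + c v)
    pointwise v with s v + c v in eq
    ... | zero = ≤-trans (≤-reflexive (cong (14 *_) g≡0)) z≤n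
      where
      g≡0 : g v ≡ 0
      g≡0 = n≤0⇒n≡0 (≤-trans (g≤d[s+c] v) (≤-reflexive (trans (cong (d v *_) eq) (*-zeroʳ (d v)))))
    ... | suc k = begin
      14 * g v                 ≡⟨ lem (g v) ⟩
      2 * (g v * 7)            ≤⟨ 2ab≤a²+b² (g v) 7 ⟩
      g v * g v + 49           ≤⟨ +-mono-≤ (*-monoʳ-≤ (g v) (g≤d v)) (*-monoʳ-≤ 49 {1} (s≤s z≤n)) ⟩
      g v * d v + 49 * suc k ∎
      where
      open ≤-Reasoning
      lem : ∀ x → 14 * x ≡ 2 * (x * 7)
      lem = solve-∀

    13t≤W : 13 * t ≤ W
    13t≤W = begin
      13 * t                     ≡⟨ *-comm 13 t ⟩
      t * 13                     ≡⟨ ∑-const N 13 ⟨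
      ∑ N (λ _ → 13)             ≤⟨ ∑-mono N (λ e e∈ → All.lookup N-heavy e∈) ⟩
      ∑ N (ends d)               ≡⟨ ∑-ends N d ⟩
      ∑ᵛ (λ v → s v * d v)       ≡⟨ ∑-cong (allFin n) (λ v → *-comm (s v) (d v)) ⟩
      ∑ᵛ (λ v → d v * s v)       ≡⟨ ∑-ends H s ⟨
      W ∎
      where open ≤-Reasoning

    ∑g : ∑ᵛ g ≡ W * 2
    ∑g = begin
      ∑ᵛ g                          ≡⟨ ∑-cong (allFin n) (λ v → sym (*-identityʳ (g v))) ⟩
      ∑ᵛ (λ v → g v * 1)            ≡⟨ ∑-weighted-ends H w (λ _ → 1) ⟨
      ∑ H (λ e → w e * 2)           ≡⟨ ∑-*ʳ H 2 w ⟩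
      W * 2 ∎
      where open ≡-Reasoning

    ∑gd : ∑ᵛ (λ v → g v * d v) ≤ W * 14
    ∑gd = begin
      ∑ᵛ (λ v → g v * d v)          ≡⟨ ∑-weighted-ends H w d ⟨
      ∑ H (λ e → w e * ends d e)    ≤⟨ ∑-mono H (λ e e∈ → *-monoʳ-≤ (w e) (All.lookup H-bounded e∈)) ⟩
      ∑ H (λ e → w e * 14)          ≡⟨ ∑-*ʳ H 14 w ⟩
      W * 14 ∎
      where open ≤-Reasoning

    14W≤ : 14 * W ≤ 49 * (t * 2 + q)
    14W≤ = +-cancelˡ-≤ (W * 14) _ _ (begin
      W * 14 + 14 * W                       ≡⟨ lem W ⟩
      14 * (W * 2)                          ≡⟨ cong (14 *_) (sym ∑g) ⟩
      14 * ∑ᵛ g                             ≡⟨ ∑-*ˡ (allFin n) 14 g ⟨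
      ∑ᵛ (λ v → 14 * g v)                   ≤⟨ ∑-mono (allFin n) (λ v _ → pointwise v) ⟩
      ∑ᵛ (λ v → g v * d v + 49 * (s v + c v)) ≡⟨ ∑-+ (allFin n) (λ v → g v * d v) (λ v → 49 * (s v + c v)) ⟩
      ∑ᵛ (λ v → g v * d v) + ∑ᵛ (λ v → 49 * (s v + c v))
        ≡⟨ cong (∑ᵛ (λ v → g v * d v) +_) (trans (∑-*ˡ (allFin n) 49 (λ v → s v + c v)) (cong (49 *_) (∑-+ (allFin n) s c))) ⟩
      ∑ᵛ (λ v → g v * d v) + 49 * (∑ᵛ s + q)
        ≤⟨ +-mono-≤ ∑gd (≤-reflexive (cong (λ z → 49 * (z + q)) (∑ᵛ-deg N))) ⟩
      W * 14 + 49 * (t * 2 + q) ∎)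
      where
      open ≤-Reasoning
      lem : ∀ W → W * 14 + 14 * W ≡ 14 * (W * 2)
      lem = solve-∀

  uncovered-few : 12 * length N ≤ 7 * size C
  uncovered-few = *-cancelˡ-≤ 7 (+-cancelˡ-≤ (98 * t) _ _ (begin
    98 * t + 7 * (12 * t)       ≡⟨ lem₁ t ⟩
    14 * (13 * t)               ≤⟨ *-monoʳ-≤ 14 13t≤W ⟩
    14 * W                      ≤⟨ 14W≤ ⟩
    49 * (t * 2 + q)            ≡⟨ lem₂ t q ⟩
    98 * t + 7 * (7 * q) ∎))
    where
    open ≤-Reasoning
    lem₁ : ∀ t → 98 * t + 7 * (12 * t) ≡ 14 * (13 * t)
    lem₁ = solve-∀
    lem₂ : ∀ t q → 49 * (t * 2 + q) ≡ 98 * t + 7 * (7 * q)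
    lem₂ = solve-∀

-- The potential 27 |H| − ∑ deg², which grows with every insertion of an underfull edge
-- and does not drop when an overfull one is deleted.

sumSq : List (Edge n) → ℕ
sumSq H = ∑ᵛ λ v → deg H v * deg H v

ends-inc : ∀ {e : Edge n} → Proper e → ends (inc e) e ≡ 2
ends-inc {e = a , b} a≢b with a Fin.≟ b | b Fin.≟ a
... | yes p | _ = contradiction p a≢b
... | no _ | yes p = contradiction (sym p) a≢b
... | no _ | no _ = cong₂ (λ x y → x + 0 + y) (δ-refl a) (δ-refl b)

module _ {e : Edge n} {G H : List (Edge n)} (proper : Proper e)
  (deg≡ : ∀ v → deg G v ≡ inc e v + deg H v) where

  ends-insert : ends (deg G) e ≡ 2 + ends (deg H) e
  ends-insert = begin
    ends (deg G) e                                   ≡⟨ cong₂ _+_ (deg≡ (proj₁ e)) (deg≡ (proj₂ e)) ⟩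
    (inc e (proj₁ e) + deg H (proj₁ e)) + (inc e (proj₂ e) + deg H (proj₂ e))
      ≡⟨ +-interchange (inc e (proj₁ e)) _ _ _ ⟩
    ends (inc e) e + ends (deg H) e                  ≡⟨ cong (_+ ends (deg H) e) (ends-inc proper) ⟩
    2 + ends (deg H) e ∎
    where open ≡-Reasoning

  sumSq-insert : sumSq G ≡ sumSq H + (2 * ends (deg H) e + 2)
  sumSq-insert = begin
    sumSq G
      ≡⟨ ∑-cong (allFin n) (λ v → trans (cong (λ z → z * z) (deg≡ v)) (square (inc e v) (deg H v))) ⟩
    ∑ᵛ (λ v → deg H v * deg H v + inc e v * (2 * deg H v + inc e v))
      ≡⟨ ∑-+ (allFin n) (λ v → deg H v * deg H v) (λ v → inc e v * (2 * deg H v + inc e v)) ⟩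
    sumSq H + ∑ᵛ (λ v → inc e v * (2 * deg H v + inc e v))
      ≡⟨ cong (sumSq H +_) (∑-inc e (λ v → 2 * deg H v + inc e v)) ⟩
    sumSq H + ends (λ v → 2 * deg H v + inc e v) e
      ≡⟨ cong (sumSq H +_) (lem (deg H (proj₁ e)) (inc e (proj₁ e)) (deg H (proj₂ e)) (inc e (proj₂ e))) ⟩
    sumSq H + (2 * ends (deg H) e + ends (inc e) e)
      ≡⟨ cong (λ z → sumSq H + (2 * ends (deg H) e + z)) (ends-inc proper) ⟩
    sumSq H + (2 * ends (deg H) e + 2) ∎
    where
    open ≡-Reasoning
    square : ∀ i d → (i + d) * (i + d) ≡ d * d + i * (2 * d + i)
    square = solve-∀
    lem : ∀ x i y j → (2 * x + i) + (2 * y + j) ≡ 2 * (x + y) + (i + j)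
    lem = solve-∀

-- In `gain` the potentials of H and `kept` are compared, with the subtracted terms moved to the
-- other side.
record Pruning (H : List (Edge n)) : Set where
  field
    kept : List (Edge n)
    kept⊆ : kept ⊆ H
    bounded : All (λ e → ends (deg kept) e ≤ 14) kept
    gain : All Proper H → 27 * length H + sumSq kept ≤ 27 * length kept + sumSq H

abstract
  prune : (H : List (Edge n)) → Pruning H
  prune {n} H₀ = go (length H₀) H₀ ≤-refl
    where
    go : ∀ k (H : List (Edge n)) → length H ≤ k → Pruning H
    go k H H≤k with All.all? (λ e → ends (deg H) e ≤? 14) H
    ... | yes b = record { kept = H ; kept⊆ = ⊆-refl ; bounded = b ; gain = λ _ → ≤-refl }
    go zero [] H≤k | no ¬b = contradiction [] ¬b
    go (suc k) H H≤k | no ¬b with find (All.¬All⇒Any¬ (λ e → ends (deg H) e ≤? 14) H ¬b)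
    ... | e , e∈H , overfull = record
      { kept = P.kept ; kept⊆ = ⊆-trans P.kept⊆ sub ; bounded = P.bounded
      ; gain = λ proper → combine (All.lookup proper e∈H) (P.gain (All-resp-⊆ sub proper)) }
      where
      open Deletion (delete e∈H)
      module P = Pruning (go k rest (s≤s⁻¹ (subst (_≤ suc k) (sym len) H≤k)))
      combine : Proper e → 27 * length rest + sumSq P.kept ≤ 27 * length P.kept + sumSq rest →
        27 * length H + sumSq P.kept ≤ 27 * length P.kept + sumSq H
      combine pr ih = begin
        27 * length H + sumSq P.kept                ≡⟨ cong (λ z → 27 * z + sumSq P.kept) (sym len) ⟩
        27 * suc (length rest) + sumSq P.kept       ≡⟨ lem₁ (length rest) (sumSq P.kept) ⟩
        (27 * length rest + sumSq P.kept) + 27      ≤⟨ +-mono-≤ ih step≥27 ⟩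
        (27 * length P.kept + sumSq rest) + (2 * ends (deg rest) e + 2)
                                                    ≡⟨ +-assoc (27 * length P.kept) (sumSq rest) _ ⟩
        27 * length P.kept + (sumSq rest + (2 * ends (deg rest) e + 2))
                                                    ≡⟨ cong (27 * length P.kept +_) (sumSq-insert {G = H} {H = rest} pr deg≡) ⟨
        27 * length P.kept + sumSq H ∎
        where
        open ≤-Reasoning
        deg≡ : ∀ v → deg H v ≡ inc e v + deg rest v
        deg≡ v = sum (λ f → inc f v)
        lem₁ : ∀ r s → 27 * suc r + s ≡ (27 * r + s) + 27
        lem₁ = solve-∀
        -- The edge e contributed 2 to a degree sum of at least 15. Its removal lowers the sum of
        -- squares by at least 2 * 13 + 2 = 28, more than the 27 lost with the edge.
        heavy : 13 ≤ ends (deg rest) e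
        heavy = s≤s⁻¹ (s≤s⁻¹ (subst (14 <_) (ends-insert {G = H} {H = rest} pr deg≡) (≰⇒> overfull)))
        step≥27 : 27 ≤ 2 * ends (deg rest) e + 2
        step≥27 = ≤-trans (n≤1+n 27) (+-monoˡ-≤ 2 (*-monoʳ-≤ 2 heavy))

-- Since 2|H| = ∑ deg, it suffices that 27 d ≤ 2 d² + 392 at each vertex: the constant 392 = 28 * 14
-- suffices for d ≤ 14, and 28 d ≤ 2 d² beyond.
potential≤ : ∀ (H : List (Edge n)) → 27 * length H ≤ sumSq H + 196 * n
potential≤ {n} H = *-cancelˡ-≤ 2 (begin
  2 * (27 * length H)                              ≡⟨ lem (length H) ⟩
  27 * (length H * 2)                              ≡⟨ cong (27 *_) (∑ᵛ-deg H) ⟨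
  27 * ∑ᵛ (deg H)                                  ≡⟨ ∑-*ˡ (allFin n) 27 (deg H) ⟨
  ∑ᵛ (λ v → 27 * deg H v)                          ≤⟨ ∑-mono (allFin n) (λ v _ → pointwise (deg H v)) ⟩
  ∑ᵛ (λ v → 2 * (deg H v * deg H v) + 392)         ≡⟨ ∑-+ (allFin n) (λ v → 2 * (deg H v * deg H v)) (λ _ → 392) ⟩
  ∑ᵛ (λ v → 2 * (deg H v * deg H v)) + ∑ᵛ {n} (λ _ → 392)
    ≡⟨ cong₂ _+_ (∑-*ˡ (allFin n) 2 (λ v → deg H v * deg H v)) (∑ᵛ-const {n} 392) ⟩
  2 * sumSq H + n * 392                            ≡⟨ lem₂ (sumSq H) n ⟩
  2 * (sumSq H + 196 * n) ∎)
  where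
  open ≤-Reasoning
  lem : ∀ l → 2 * (27 * l) ≡ 27 * (l * 2)
  lem = solve-∀
  lem₂ : ∀ s n → 2 * s + n * 392 ≡ 2 * (s + 196 * n)
  lem₂ = solve-∀
  pointwise : ∀ d → 27 * d ≤ 2 * (d * d) + 392
  pointwise d with d ≤? 14
  ... | yes d≤14 = begin
    27 * d                   ≤⟨ *-monoʳ-≤ 27 d≤14 ⟩
    378                      ≤⟨ m≤m+n 378 14 ⟩
    392                      ≤⟨ m≤n+m 392 _ ⟩
    2 * (d * d) + 392 ∎
  ... | no d≰14 = begin
    27 * d                   ≤⟨ *-monoˡ-≤ d (m≤m+n 27 1) ⟩
    28 * d                   ≡⟨ *-assoc 2 14 d ⟩
    2 * (14 * d)             ≤⟨ *-monoʳ-≤ 2 (*-monoˡ-≤ d (<⇒≤ (≰⇒> d≰14))) ⟩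
    2 * (d * d)              ≤⟨ m≤m+n _ 392 ⟩
    2 * (d * d) + 392 ∎

-- Orderings of a list

∑-concatMap : ∀ (g : A → List B) xs f → ∑ (concatMap g xs) f ≡ ∑ xs (λ x → ∑ (g x) f)
∑-concatMap g [] f = refl
∑-concatMap g (x ∷ xs) f = trans (∑-++ (g x) (concatMap g xs) f) (cong (∑ (g x) f +_) (∑-concatMap g xs f))

∑-↭ : ∀ {xs ys : List A} (f : A → ℕ) → xs ↭ ys → ∑ xs f ≡ ∑ ys f
∑-↭ f ↭.refl = refl
∑-↭ f (↭.prep x p) = cong (f x +_) (∑-↭ f p)
∑-↭ f (↭.swap x y p) = trans (cong (λ s → f x + (f y + s)) (∑-↭ f p)) (+-swapˡ (f x) (f y) _)
∑-↭ f (↭.trans p q) = trans (∑-↭ f p) (∑-↭ f q)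

∈-inserts⇒↭ : ∀ {x : A} τ {σ} → σ ∈ inserts x τ → σ ↭ x ∷ τ
∈-inserts⇒↭ [] (here refl) = ↭-refl
∈-inserts⇒↭ (y ∷ τ) (here refl) = ↭-refl
∈-inserts⇒↭ (y ∷ τ) (there p) with ∈-map⁻ (y ∷_) p
... | ρ , ρ∈ , refl = ↭-trans (↭-prep y (∈-inserts⇒↭ τ ρ∈)) (↭-swap y _ ↭-refl)

∈-perms⇒↭ : ∀ (xs : List A) {σ} → σ ∈ perms xs → σ ↭ xs
∈-perms⇒↭ [] (here refl) = ↭-refl
∈-perms⇒↭ (x ∷ xs) p with find (∈-concatMap⁻ (inserts x) {xs = perms xs} p)
... | τ , τ∈ , σ∈ = ↭-trans (∈-inserts⇒↭ τ σ∈) (↭-prep x (∈-perms⇒↭ xs τ∈))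

-- Random orderings

picks : List A → List (A × List A)
picks [] = []
picks (x ∷ xs) = (x , xs) ∷ map (map₂ (x ∷_)) (picks xs)

-- In a uniformly random ordering, the first element is uniform, and given the first
-- element the others are again in uniformly random order.
∑-perms : ∀ x (xs : List A) (F : List A → ℕ) →
  ∑ (perms (x ∷ xs)) F ≡ ∑ (picks (x ∷ xs)) (λ (y , R) → ∑ (perms R) (λ σ → F (y ∷ σ)))
∑-perms {A} x xs F = begin
  ∑ (perms (x ∷ xs)) F                              ≡⟨ ∑-concatMap (inserts x) (perms xs) F ⟩
  ∑ (perms xs) (λ τ → ∑ (inserts x τ) F)            ≡⟨ ∑-cong (perms xs) inserts-split ⟩
  ∑ (perms xs) (λ τ → F (x ∷ τ) + later τ)          ≡⟨ ∑-+ (perms xs) (λ τ → F (x ∷ τ)) later ⟩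
  ∑ (perms xs) (λ τ → F (x ∷ τ)) + ∑ (perms xs) later
    ≡⟨ cong (∑ (perms xs) (λ τ → F (x ∷ τ)) +_) (∑-later xs) ⟩
  ∑ (picks (x ∷ xs)) (λ (y , R) → ∑ (perms R) (λ σ → F (y ∷ σ))) ∎
  where
  open ≡-Reasoning
  later : List A → ℕ
  later [] = 0
  later (y ∷ τ) = ∑ (inserts x τ) (λ σ → F (y ∷ σ))
  inserts-split : ∀ τ → ∑ (inserts x τ) F ≡ F (x ∷ τ) + later τ
  inserts-split [] = refl
  inserts-split (y ∷ τ) = cong (F (x ∷ y ∷ τ) +_) (∑-map (y ∷_) (inserts x τ) F)
  ∑-later : ∀ zs → ∑ (perms zs) later ≡ ∑ (map (map₂ (x ∷_)) (picks zs)) (λ (y , R) → ∑ (perms R) (λ σ → F (y ∷ σ)))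
  ∑-later [] = refl
  ∑-later (z ∷ zs) = begin
    ∑ (perms (z ∷ zs)) later
      ≡⟨ ∑-perms z zs later ⟩
    ∑ (picks (z ∷ zs)) (λ (y , R) → ∑ (perms R) (λ τ → ∑ (inserts x τ) (λ σ → F (y ∷ σ))))
      ≡⟨ ∑-cong (picks (z ∷ zs)) (λ (y , R) → sym (∑-concatMap (inserts x) (perms R) (λ σ → F (y ∷ σ)))) ⟩
    ∑ (picks (z ∷ zs)) (λ (y , R) → ∑ (perms (x ∷ R)) (λ σ → F (y ∷ σ)))
      ≡⟨ ∑-map (map₂ (x ∷_)) (picks (z ∷ zs)) (λ (y , R) → ∑ (perms R) (λ σ → F (y ∷ σ))) ⟨
    ∑ (map (map₂ (x ∷_)) (picks (z ∷ zs))) (λ (y , R) → ∑ (perms R) (λ σ → F (y ∷ σ))) ∎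

∑-picks : ∀ (xs : List A) (f : A → ℕ) → ∑ (picks xs) (λ (y , _) → f y) ≡ ∑ xs f
∑-picks [] f = refl
∑-picks (x ∷ xs) f = cong (f x +_) (trans (∑-map (map₂ (x ∷_)) (picks xs) (λ (y , _) → f y)) (∑-picks xs f))

∑-pick : ∀ (xs : List A) {y R} (f : A → ℕ) → (y , R) ∈ picks xs → ∑ xs f ≡ f y + ∑ R f
∑-pick (x ∷ xs) f (here refl) = refl
∑-pick (x ∷ xs) f (there p) with ∈-map⁻ (map₂ (x ∷_)) p
... | (y , R) , q , refl = trans (cong (f x +_) (∑-pick xs f q)) (+-swapˡ (f x) (f y) _)

length-∑ : ∀ (xs : List A) → length xs ≡ ∑ xs (λ _ → 1)
length-∑ xs = trans (sym (*-identityʳ (length xs))) (sym (∑-const xs 1))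

length-pick : ∀ (xs : List A) {y R} → (y , R) ∈ picks xs → length xs ≡ suc (length R)
length-pick xs {R = R} p = trans (length-∑ xs) (trans (∑-pick xs (λ _ → 1) p) (cong suc (sym (length-∑ R))))

pick-tail : ∀ {x} {xs : List A} {y R} → (y , R) ∈ picks (x ∷ xs) → length R ≡ length xs
pick-tail {xs = xs} p = sym (suc-injective (length-pick (_ ∷ xs) p))

length-perms : ∀ (xs : List A) → length (perms xs) ≡ length xs !
length-perms xs = trans (length-∑ (perms xs)) (go (length xs) xs refl)
  where
  open ≡-Reasoning
  go : ∀ r (xs : List A) → length xs ≡ r → ∑ (perms xs) (λ _ → 1) ≡ r !
  go zero [] refl = refl
  go (suc r) (x ∷ xs) refl = begin
    ∑ (perms (x ∷ xs)) (λ _ → 1)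
      ≡⟨ ∑-perms x xs (λ _ → 1) ⟩
    ∑ (picks (x ∷ xs)) (λ (_ , R) → ∑ (perms R) (λ _ → 1))
      ≡⟨ ∑-cong∈ (picks (x ∷ xs)) (λ (_ , R) p → go r R (pick-tail p)) ⟩
    ∑ (picks (x ∷ xs)) (λ _ → r !)
      ≡⟨ ∑-picks (x ∷ xs) (λ _ → r !) ⟩
    ∑ (x ∷ xs) (λ _ → r !)
      ≡⟨ ∑-const (x ∷ xs) (r !) ⟩
    suc r * r ! ∎
    where
    ∑-cong∈ : ∀ {B : Set} (ys : List B) {f g : B → ℕ} → (∀ y → y ∈ ys → f y ≡ g y) → ∑ ys f ≡ ∑ ys g
    ∑-cong∈ ys h = ≤-antisym (∑-mono ys λ y p → ≤-reflexive (h y p)) (∑-mono ys λ y p → ≤-reflexive (sym (h y p)))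

count-not : ∀ (p : A → Bool) xs → count (not ∘ p) xs + count p xs ≡ length xs
count-not p xs = trans (sym (∑-+ xs (ind ∘ not ∘ p) (ind ∘ p))) (trans (∑-cong xs (λ x → one (p x))) (sym (length-∑ xs)))
  where
  one : ∀ b → ind (not b) + ind b ≡ 1
  one true = refl
  one false = refl

-- The induction step shared by the estimates below: a bound for every first element y, with weight
-- `k y`, is averaged over y. The factors s and c carry the cleared denominators.
∑-perms-step : ∀ x (xs : List A) (F : List A → ℕ) (k : A → ℕ) s c →
  (∀ y R → (y , R) ∈ picks (x ∷ xs) → ∑ (perms R) (λ σ → F (y ∷ σ)) * s ≤ k y * c) →
  ∑ (perms (x ∷ xs)) F * s ≤ ∑ (x ∷ xs) k * c
∑-perms-step x xs F k s c h = begin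
  ∑ (perms (x ∷ xs)) F * s
    ≡⟨ cong (_* s) (∑-perms x xs F) ⟩
  ∑ (picks (x ∷ xs)) (λ (y , R) → ∑ (perms R) (λ σ → F (y ∷ σ))) * s
    ≡⟨ ∑-*ʳ (picks (x ∷ xs)) s (λ (y , R) → ∑ (perms R) (λ σ → F (y ∷ σ))) ⟨
  ∑ (picks (x ∷ xs)) (λ (y , R) → ∑ (perms R) (λ σ → F (y ∷ σ)) * s)
    ≤⟨ ∑-mono (picks (x ∷ xs)) (λ (y , R) p → h y R p) ⟩
  ∑ (picks (x ∷ xs)) (λ (y , _) → k y * c)
    ≡⟨ ∑-picks (x ∷ xs) (λ y → k y * c) ⟩
  ∑ (x ∷ xs) (λ y → k y * c)
    ≡⟨ ∑-*ʳ (x ∷ xs) c k ⟩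
  ∑ (x ∷ xs) k * c ∎
  where open ≤-Reasoning

-- The value 1 at a list that ends inside the window fits the estimate below: such a list avoids U
-- only if it contains no element of U at all.
avoiding : (A → Bool) → ℕ → List A → ℕ
avoiding U zero σ = 1
avoiding U (suc a) [] = 1
avoiding U (suc a) (e ∷ σ) = if U e then 0 else avoiding U a σ

-- Drawing without replacement only helps to hit U, so x + u may stay fixed throughout.
∑-avoiding : ∀ (U : A → Bool) a R x u → u ≤ count U R → length R ≤ x + u →
  ∑ (perms R) (avoiding U a) * (x + u) ^ a ≤ x ^ a * length R !
∑-avoiding U zero R x u u≤ R≤ = ≤-reflexive (begin
  ∑ (perms R) (λ _ → 1) * 1   ≡⟨ *-identityʳ _ ⟩
  ∑ (perms R) (λ _ → 1)       ≡⟨ length-∑ (perms R) ⟨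
  length (perms R)            ≡⟨ length-perms R ⟩
  length R !                  ≡⟨ *-identityˡ _ ⟨
  1 * length R ! ∎)
  where open ≡-Reasoning
∑-avoiding U (suc a) [] x u u≤ R≤ = ≤-reflexive (begin
  (x + u) ^ suc a + 0                ≡⟨ +-identityʳ _ ⟩
  (x + u) ^ suc a                    ≡⟨ cong (_^ suc a) (trans (cong (x +_) (n≤0⇒n≡0 u≤)) (+-identityʳ x)) ⟩
  x ^ suc a                          ≡⟨ *-identityʳ _ ⟨
  x ^ suc a * 1 ∎)
  where open ≡-Reasoning
∑-avoiding U (suc a) R@(y₀ ∷ R₀) x u u≤ R≤ = begin
  ∑ (perms R) (avoiding U (suc a)) * ((x + u) * (x + u) ^ a)
    ≡⟨ shuffle₁ (∑ (perms R) (avoiding U (suc a))) (x + u) ((x + u) ^ a) ⟩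
  ∑ (perms R) (avoiding U (suc a)) * (x + u) ^ a * (x + u)
    ≤⟨ *-monoˡ-≤ (x + u) (∑-perms-step y₀ R₀ (avoiding U (suc a)) (ind ∘ not ∘ U) ((x + u) ^ a) (x ^ a * length R₀ !) head) ⟩
  count (not ∘ U) R * (x ^ a * length R₀ !) * (x + u)
    ≡⟨ shuffle₂ (count (not ∘ U) R) (x ^ a) (length R₀ !) (x + u) ⟩
  count (not ∘ U) R * (x + u) * (x ^ a * length R₀ !)
    ≤⟨ *-monoˡ-≤ (x ^ a * length R₀ !) weight ⟩
  x * length R * (x ^ a * length R₀ !)
    ≡⟨ shuffle₃ x (length R) (x ^ a) (length R₀ !) ⟩
  x * x ^ a * (length R * length R₀ !) ∎
  where
  open ≤-Reasoning
  c = count (not ∘ U) R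
  c+u≤R : c + u ≤ length R
  c+u≤R = ≤-trans (+-monoʳ-≤ c u≤) (≤-reflexive (count-not U R))
  c≤x : c ≤ x
  c≤x = +-cancelʳ-≤ u c x (≤-trans c+u≤R R≤)
  -- The chance c / |R| of missing U is at most x / (x + u), because c + u ≤ |R| and c ≤ x.
  weight : c * (x + u) ≤ x * length R
  weight = begin
    c * (x + u)     ≡⟨ *-distribˡ-+ c x u ⟩
    c * x + c * u   ≤⟨ +-mono-≤ (≤-reflexive (*-comm c x)) (*-monoˡ-≤ u c≤x) ⟩
    x * c + x * u   ≡⟨ *-distribˡ-+ x c u ⟨
    x * (c + u)     ≤⟨ *-monoʳ-≤ x c+u≤R ⟩
    x * length R ∎
  head : ∀ y R′ → (y , R′) ∈ picks R → ∑ (perms R′) (λ σ → avoiding U (suc a) (y ∷ σ)) * (x + u) ^ a ≤ ind (not (U y)) * (x ^ a * length R₀ !)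
  head y R′ p with U y in Uy
  ... | true = ≤-reflexive (cong (_* (x + u) ^ a) (∑-zero (perms R′)))
  ... | false = begin
    ∑ (perms R′) (avoiding U a) * (x + u) ^ a
      ≤⟨ ∑-avoiding U a R′ x u
           (≤-trans u≤ (≤-reflexive (trans (∑-pick R (ind ∘ U) p) (cong (λ b → ind b + count U R′) Uy))))
           (≤-trans (n≤1+n _) (≤-trans (≤-reflexive (sym (length-pick R p))) R≤)) ⟩
    x ^ a * length R′ !            ≡⟨ cong (λ l → x ^ a * l !) (pick-tail {x = y₀} p) ⟩
    x ^ a * length R₀ !            ≡⟨ *-identityˡ _ ⟨
    1 * (x ^ a * length R₀ !) ∎
  shuffle₁ : ∀ s m p → s * (m * p) ≡ s * p * m
  shuffle₁ = solve-∀
  shuffle₂ : ∀ c p f m → c * (p * f) * m ≡ c * m * (p * f)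
  shuffle₂ = solve-∀
  shuffle₃ : ∀ x r p f → x * r * (p * f) ≡ x * p * (r * f)
  shuffle₃ = solve-∀

-- (1 + z)^X, where X counts the elements of V among the first T; its mean is the
-- exponential moment in a Chernoff bound.
tilt : ℕ → (A → Bool) → ℕ → List A → ℕ
tilt z V zero σ = 1
tilt z V (suc T) [] = 1
tilt z V (suc T) (e ∷ σ) = (1 + ind (V e) * z) * tilt z V T σ

-- During all T draws at least s elements remain, at most u of them in V, so each draw multiplies
-- the mean by at most 1 + z u / s.
∑-tilt : ∀ z (V : A → Bool) T R s u → count V R ≤ u → s + T ≤ length R →
  ∑ (perms R) (tilt z V T) * s ^ T ≤ (s + z * u) ^ T * length R !
∑-tilt z V zero R s u V≤u R≥ = ≤-reflexive (begin
  ∑ (perms R) (λ _ → 1) * 1   ≡⟨ *-identityʳ _ ⟩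
  ∑ (perms R) (λ _ → 1)       ≡⟨ length-∑ (perms R) ⟨
  length (perms R)            ≡⟨ length-perms R ⟩
  length R !                  ≡⟨ *-identityˡ _ ⟨
  1 * length R ! ∎)
  where open ≡-Reasoning
∑-tilt z V (suc T) [] s u V≤u R≥ with () ← ≤-trans (m≤n+m (suc T) s) R≥
∑-tilt z V (suc T) R@(y₀ ∷ R₀) s u V≤u R≥ = begin
  ∑ (perms R) (tilt z V (suc T)) * (s * s ^ T)
    ≡⟨ shuffle₁ (∑ (perms R) (tilt z V (suc T))) s (s ^ T) ⟩
  ∑ (perms R) (tilt z V (suc T)) * s ^ T * s
    ≤⟨ *-monoˡ-≤ s (∑-perms-step y₀ R₀ (tilt z V (suc T)) (λ e → 1 + ind (V e) * z) (s ^ T) ((s + z * u) ^ T * length R₀ !) head) ⟩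
  ∑ R (λ e → 1 + ind (V e) * z) * ((s + z * u) ^ T * length R₀ !) * s
    ≡⟨ cong (λ w → w * ((s + z * u) ^ T * length R₀ !) * s) total ⟩
  (length R + count V R * z) * ((s + z * u) ^ T * length R₀ !) * s
    ≡⟨ shuffle₂ (length R + count V R * z) ((s + z * u) ^ T) (length R₀ !) s ⟩
  (length R + count V R * z) * s * ((s + z * u) ^ T * length R₀ !)
    ≤⟨ *-monoˡ-≤ ((s + z * u) ^ T * length R₀ !) weight ⟩
  (s + z * u) * length R * ((s + z * u) ^ T * length R₀ !)
    ≡⟨ shuffle₃ (s + z * u) (length R) ((s + z * u) ^ T) (length R₀ !) ⟩
  (s + z * u) * (s + z * u) ^ T * (length R * length R₀ !) ∎
  where
  open ≤-Reasoning
  total : ∑ R (λ e → 1 + ind (V e) * z) ≡ length R + count V R * z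
  total = trans (∑-+ R (λ _ → 1) (λ e → ind (V e) * z)) (cong₂ _+_ (sym (length-∑ R)) (∑-*ʳ R z (ind ∘ V)))
  shuffle₀ : ∀ r c z s → (r + c * z) * s ≡ s * r + z * c * s
  shuffle₀ = solve-∀
  weight : (length R + count V R * z) * s ≤ (s + z * u) * length R
  weight = begin
    (length R + count V R * z) * s          ≡⟨ shuffle₀ (length R) (count V R) z s ⟩
    s * length R + z * count V R * s        ≤⟨ +-monoʳ-≤ (s * length R) (*-mono-≤ (*-monoʳ-≤ z V≤u) (≤-trans (m≤m+n s (suc T)) R≥)) ⟩
    s * length R + z * u * length R         ≡⟨ *-distribʳ-+ (length R) s (z * u) ⟨
    (s + z * u) * length R ∎
  head : ∀ y R′ → (y , R′) ∈ picks R →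
    ∑ (perms R′) (λ σ → (1 + ind (V y) * z) * tilt z V T σ) * s ^ T ≤ (1 + ind (V y) * z) * ((s + z * u) ^ T * length R₀ !)
  head y R′ p = begin
    ∑ (perms R′) (λ σ → (1 + ind (V y) * z) * tilt z V T σ) * s ^ T
      ≡⟨ cong (_* s ^ T) (∑-*ˡ (perms R′) (1 + ind (V y) * z) (tilt z V T)) ⟩
    (1 + ind (V y) * z) * ∑ (perms R′) (tilt z V T) * s ^ T
      ≡⟨ *-assoc (1 + ind (V y) * z) (∑ (perms R′) (tilt z V T)) (s ^ T) ⟩
    (1 + ind (V y) * z) * (∑ (perms R′) (tilt z V T) * s ^ T)
      ≤⟨ *-monoʳ-≤ (1 + ind (V y) * z) (∑-tilt z V T R′ s u
           (≤-trans (m≤n+m _ (ind (V y))) (≤-trans (≤-reflexive (sym (∑-pick R (ind ∘ V) p))) V≤u))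
           (s≤s⁻¹ (≤-trans (≤-reflexive (sym (+-suc s T))) (≤-trans R≥ (≤-reflexive (length-pick R p)))))) ⟩
    (1 + ind (V y) * z) * ((s + z * u) ^ T * length R′ !)
      ≡⟨ cong (λ l → (1 + ind (V y) * z) * ((s + z * u) ^ T * l !)) (pick-tail {x = y₀} p) ⟩
    (1 + ind (V y) * z) * ((s + z * u) ^ T * length R₀ !) ∎
  shuffle₁ : ∀ a m p → a * (m * p) ≡ a * p * m
  shuffle₁ = solve-∀
  shuffle₂ : ∀ c p f m → c * (p * f) * m ≡ c * m * (p * f)
  shuffle₂ = solve-∀
  shuffle₃ : ∀ x r p f → x * r * (p * f) ≡ x * p * (r * f)
  shuffle₃ = solve-∀

-- (1 + z/s)^k (1 − k z/s) ≤ 1, with x = s − k z and without subtraction.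
compound : ∀ s z k x → x + k * z ≤ s → (s + z) ^ k * x ≤ s ^ k * (x + k * z)
compound s z zero x h = ≤-reflexive (cong (1 *_) (sym (+-identityʳ x)))
compound s z (suc k) x h = begin
  (s + z) * (s + z) ^ k * x          ≡⟨ shuffle₁ (s + z) ((s + z) ^ k) x ⟩
  (s + z) ^ k * ((s + z) * x)        ≤⟨ *-monoʳ-≤ ((s + z) ^ k) step≤ ⟩
  (s + z) ^ k * (s * (x + z))        ≡⟨ shuffle₂ ((s + z) ^ k) s (x + z) ⟩
  s * ((s + z) ^ k * (x + z))        ≤⟨ *-monoʳ-≤ s (compound s z k (x + z) (≤-trans (≤-reflexive (+-assoc x z (k * z))) h)) ⟩
  s * (s ^ k * (x + z + k * z))      ≡⟨ *-assoc s _ _ ⟨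
  s * s ^ k * (x + z + k * z)        ≡⟨ cong (s * s ^ k *_) (+-assoc x z (k * z)) ⟩
  s * s ^ k * (x + (z + k * z)) ∎
  where
  open ≤-Reasoning
  shuffle₁ : ∀ a b x → a * b * x ≡ b * (a * x)
  shuffle₁ = solve-∀
  shuffle₂ : ∀ a b x → a * (b * x) ≡ b * (a * x)
  shuffle₂ = solve-∀
  shuffle₃ : ∀ s z x → (s + z) * x ≡ s * x + x * z
  shuffle₃ = solve-∀
  step≤ : (s + z) * x ≤ s * (x + z)
  step≤ = begin
    (s + z) * x      ≡⟨ shuffle₃ s z x ⟩
    s * x + x * z    ≤⟨ +-monoʳ-≤ (s * x) (*-monoˡ-≤ z (≤-trans (m≤m+n x _) h)) ⟩
    s * x + s * z    ≡⟨ *-distribˡ-+ s x z ⟨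
    s * (x + z) ∎

-- At x = T z, `compound` has the ratio 2 T z / (T z). Cancelling T z requires a separate case in
-- which T or z vanishes.
compound≤2 : ∀ s z T → 2 * (T * z) ≤ s → (s + z) ^ T ≤ 2 * s ^ T
compound≤2 s z T h with T * z in eq
... | zero with m*n≡0⇒m≡0∨n≡0 T eq
...   | inj₁ refl = s≤s z≤n
...   | inj₂ refl = ≤-trans (≤-reflexive (cong (_^ T) (+-identityʳ s))) (m≤n*m (s ^ T) 2)
compound≤2 s z T h | suc k = *-cancelʳ-≤ ((s + z) ^ T) (2 * s ^ T) (suc k) (begin
  (s + z) ^ T * suc k          ≤⟨ subst (λ w → (s + z) ^ T * w ≤ s ^ T * (w + T * z)) eq (compound s z T (T * z) (≤-trans (≤-reflexive (twice (T * z))) (subst (λ w → 2 * w ≤ s) (sym eq) h))) ⟩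
  s ^ T * (suc k + T * z)      ≡⟨ cong (λ w → s ^ T * (suc k + w)) eq ⟩
  s ^ T * (suc k + suc k)      ≡⟨ shuffle (s ^ T) (suc k) ⟩
  2 * s ^ T * suc k ∎)
  where
  open ≤-Reasoning
  twice : ∀ w → w + w ≡ 2 * w
  twice = solve-∀
  shuffle : ∀ p w → p * (w + w) ≡ 2 * p * w
  shuffle = solve-∀

-- Each unit of u adds z to a base that is at least s ≥ 2 T z, which at most doubles the power. The
-- mean weight is therefore bounded by 2^u, however large z is.
tilted≤ : ∀ s z T u → 2 * (T * z) ≤ s → (s + z * u) ^ T ≤ 2 ^ u * s ^ T
tilted≤ s z T zero h = ≤-reflexive (trans (cong (_^ T) (trans (cong (s +_) (*-zeroʳ z)) (+-identityʳ s))) (sym (*-identityˡ (s ^ T))))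
tilted≤ s z T (suc u) h = begin
  (s + z * suc u) ^ T           ≡⟨ cong (_^ T) (shuffle s z u) ⟩
  (s + z * u + z) ^ T           ≤⟨ compound≤2 (s + z * u) z T (≤-trans h (m≤m+n s _)) ⟩
  2 * (s + z * u) ^ T           ≤⟨ *-monoʳ-≤ 2 (tilted≤ s z T u h) ⟩
  2 * (2 ^ u * s ^ T)           ≡⟨ *-assoc 2 (2 ^ u) (s ^ T) ⟨
  2 * 2 ^ u * s ^ T ∎
  where
  open ≤-Reasoning
  shuffle : ∀ s z u → s + z * suc u ≡ s + z * u + z
  shuffle = solve-∀

-- Taking s = |R| - T, the assumption becomes T + 2 T z ≤ s. This is enough for `tilted≤`, and it
-- makes s positive when R is nonempty, so that s^T can be cancelled.
∑-tilt≤2^ : ∀ z (V : A → Bool) T R → 2 * (suc z * T) ≤ length R →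
  ∑ (perms R) (tilt z V T) ≤ 2 ^ count V R * length R !
∑-tilt≤2^ z V T [] h = ≤-reflexive (lem T (n≤0⇒n≡0 (≤-trans (m≤m+n T (z * T)) (≤-trans (m≤n*m (suc z * T) 2) h))))
  where
  lem : ∀ T → T ≡ 0 → tilt z V T [] + 0 ≡ 1
  lem zero _ = refl
∑-tilt≤2^ z V T R@(_ ∷ _) h with m≤n⇒∃[o]m+o≡n (≤-trans T≤ h)
  where
  T≤ : T ≤ 2 * (suc z * T)
  T≤ = ≤-trans (m≤m+n T (z * T)) (m≤n*m (suc z * T) 2)
... | s , T+s≡ = *-cancelʳ-≤ _ _ (s ^ T) {{^-nonZero}} (begin
  ∑ (perms R) (tilt z V T) * s ^ T
    ≤⟨ ∑-tilt z V T R s (count V R) ≤-refl (≤-reflexive (trans (+-comm s T) T+s≡)) ⟩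
  (s + z * count V R) ^ T * length R !
    ≤⟨ *-monoˡ-≤ (length R !) (tilted≤ s z T (count V R) 2Tz≤s) ⟩
  2 ^ count V R * s ^ T * length R !
    ≡⟨ shuffle (2 ^ count V R) (s ^ T) (length R !) ⟩
  2 ^ count V R * length R ! * s ^ T ∎)
  where
  open ≤-Reasoning
  shuffle : ∀ a b c → a * b * c ≡ a * c * b
  shuffle = solve-∀
  expand : ∀ z T → T + (T + 2 * (T * z)) ≡ 2 * (suc z * T)
  expand = solve-∀
  T+2Tz≤s : T + 2 * (T * z) ≤ s
  T+2Tz≤s = +-cancelˡ-≤ T _ _ (≤-trans (≤-reflexive (expand z T)) (≤-trans h (≤-reflexive (sym T+s≡))))
  2Tz≤s : 2 * (T * z) ≤ s
  2Tz≤s = ≤-trans (m≤n+m _ T) T+2Tz≤s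
  s≢0 : s ≢ 0
  s≢0 refl with () ← trans (sym T+s≡) (trans (+-identityʳ T) (n≤0⇒n≡0 (≤-trans (m≤m+n T _) T+2Tz≤s)))
  ^-nonZero : NonZero (s ^ T)
  ^-nonZero = m^n≢0 s T {{≢-nonZero s≢0}}

-- Bernoulli's inequality (1 + u/x)^b ≥ 1 + b u/x, with the denominators cleared.
bernoulli : ∀ x u b → x ^ b * (x + b * u) ≤ x * (x + u) ^ b
bernoulli x u zero = ≤-reflexive (lem x)
  where
  lem : ∀ x → 1 * (x + 0) ≡ x * 1
  lem = solve-∀
bernoulli x u (suc b) = begin
  x * x ^ b * (x + (u + b * u))                     ≡⟨ shuffle₁ x (x ^ b) u (b * u) ⟩
  x * (x ^ b * (x + b * u)) + x ^ b * x * u         ≤⟨ +-monoʳ-≤ (x * (x ^ b * (x + b * u))) (*-monoˡ-≤ u (*-monoʳ-≤ (x ^ b) (m≤m+n x (b * u)))) ⟩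
  x * (x ^ b * (x + b * u)) + x ^ b * (x + b * u) * u ≡⟨ shuffle₂ x (x ^ b * (x + b * u)) u ⟩
  (x + u) * (x ^ b * (x + b * u))                   ≤⟨ *-monoʳ-≤ (x + u) (bernoulli x u b) ⟩
  (x + u) * (x * (x + u) ^ b)                       ≡⟨ shuffle₃ (x + u) x ((x + u) ^ b) ⟩
  x * ((x + u) * (x + u) ^ b) ∎
  where
  open ≤-Reasoning
  shuffle₁ : ∀ x p u v → x * p * (x + (u + v)) ≡ x * (p * (x + v)) + p * x * u
  shuffle₁ = solve-∀
  shuffle₂ : ∀ x q u → x * q + q * u ≡ (x + u) * q
  shuffle₂ = solve-∀
  shuffle₃ : ∀ y x p → y * (x * p) ≡ x * (y * p)
  shuffle₃ = solve-∀

-- As b u ≥ x, Bernoulli's inequality gives (1 + u/x)^b ≥ 1 + b u/x ≥ 2. For x = 0 the left side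
-- vanishes because b is positive.
doubling : ∀ x u b .{{_ : NonZero u}} → x + u ≤ b * u → 2 * x ^ b ≤ (x + u) ^ b
doubling x (suc u) zero h with () ← ≤-trans (≤-reflexive (sym (+-suc x u))) h
doubling zero u (suc b) h = z≤n
doubling x@(suc _) u b@(suc _) h = *-cancelˡ-≤ x (begin
  x * (2 * x ^ b)       ≡⟨ shuffle x (x ^ b) ⟩
  x ^ b * (x + x)       ≤⟨ *-monoʳ-≤ (x ^ b) (+-monoʳ-≤ x (≤-trans (m≤m+n x u) h)) ⟩
  x ^ b * (x + b * u)   ≤⟨ bernoulli x u b ⟩
  x * (x + u) ^ b ∎)
  where
  open ≤-Reasoning
  shuffle : ∀ x p → x * (2 * p) ≡ p * (x + x)
  shuffle = solve-∀

doublings : ∀ x u b ℓ .{{_ : NonZero u}} → x + u ≤ b * u → 2 ^ ℓ * x ^ (ℓ * b) ≤ (x + u) ^ (ℓ * b)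
doublings x u b zero h = ≤-refl
doublings x u b (suc ℓ) h = begin
  2 * 2 ^ ℓ * x ^ (b + ℓ * b)              ≡⟨ cong (2 * 2 ^ ℓ *_) (^-distribˡ-+-* x b (ℓ * b)) ⟩
  2 * 2 ^ ℓ * (x ^ b * x ^ (ℓ * b))        ≡⟨ shuffle 2 (2 ^ ℓ) (x ^ b) (x ^ (ℓ * b)) ⟩
  2 * x ^ b * (2 ^ ℓ * x ^ (ℓ * b))        ≤⟨ *-mono-≤ (doubling x u b h) (doublings x u b ℓ h) ⟩
  (x + u) ^ b * (x + u) ^ (ℓ * b)          ≡⟨ ^-distribˡ-+-* (x + u) b (ℓ * b) ⟨
  (x + u) ^ (b + ℓ * b) ∎
  where
  open ≤-Reasoning
  shuffle : ∀ t p a b → t * p * (a * b) ≡ t * a * (p * b)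
  shuffle = solve-∀

-- Watching a process with states S : at state h the elements of U h are the surprising
-- ones, and an alarm is a surprise-free window of length a although more than γ surprising
-- elements remain.

module Monitor {S A : Set} (U : S → A → Bool) (next : S → A → S) where

  alarm : ℕ → ℕ → S → List A → ℕ
  alarm a γ h σ = if γ <ᵇ count (U h) σ then avoiding (U h) a σ else 0

  alarms : ℕ → ℕ → S → List A → ℕ
  alarms a γ h [] = 0
  alarms a γ h (e ∷ σ) = alarm a γ h (e ∷ σ) + alarms a γ (next h e) σ

  -- With h fixed, the number of surprising elements is the same in every ordering of R. If it
  -- exceeds γ, set x + γ = b γ: a draw misses them with probability at most x / (x + γ) = 1 - 1/b,
  -- so b draws halve the probability and ℓ b draws bring it to 2^-ℓ.
  ∑-alarm : ∀ b ℓ γ .{{_ : NonZero γ}} h R → length R ≤ b * γ →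
    ∑ (perms R) (alarm (ℓ * b) γ h) * 2 ^ ℓ ≤ length R !
  ∑-alarm b ℓ γ h R R≤ = ≤-trans
    (*-monoˡ-≤ (2 ^ ℓ) (∑-mono (perms R) λ σ σ∈ → ≤-reflexive
      (cong (λ k → if γ <ᵇ k then avoiding (U h) (ℓ * b) σ else 0) (∑-↭ (ind ∘ U h) (∈-perms⇒↭ R σ∈)))))
    fixed
    where
    open ≤-Reasoning
    fixed : ∑ (perms R) (λ σ → if γ <ᵇ count (U h) R then avoiding (U h) (ℓ * b) σ else 0) * 2 ^ ℓ ≤ length R !
    fixed with γ <ᵇ count (U h) R in eq
    ... | false = ≤-trans (≤-reflexive (cong (_* 2 ^ ℓ) (∑-zero (perms R)))) z≤n
    ... | true with m≤n⇒∃[o]m+o≡n γ≤bγ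
      where
      γ<count : γ < count (U h) R
      γ<count = <ᵇ⇒< γ _ (subst T (sym eq) tt)
      γ≤bγ : γ ≤ b * γ
      γ≤bγ = ≤-trans (<⇒≤ γ<count) (≤-trans (count≤length (U h) R) R≤)
    ...   | x , γ+x≡ = *-cancelʳ-≤ _ _ ((x + γ) ^ (ℓ * b)) {{m^n≢0 (x + γ) (ℓ * b) {{≢-nonZero x+γ≢0}}}} (begin
      s * 2 ^ ℓ * (x + γ) ^ (ℓ * b)          ≡⟨ shuffle₁ s (2 ^ ℓ) ((x + γ) ^ (ℓ * b)) ⟩
      s * (x + γ) ^ (ℓ * b) * 2 ^ ℓ          ≤⟨ *-monoˡ-≤ (2 ^ ℓ) (∑-avoiding (U h) (ℓ * b) R x γ γ≤count (≤-trans R≤ (≤-reflexive (sym x+γ≡)))) ⟩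
      x ^ (ℓ * b) * length R ! * 2 ^ ℓ       ≡⟨ shuffle₂ (x ^ (ℓ * b)) (length R !) (2 ^ ℓ) ⟩
      length R ! * (2 ^ ℓ * x ^ (ℓ * b))     ≤⟨ *-monoʳ-≤ (length R !) (doublings x γ b ℓ (≤-reflexive x+γ≡)) ⟩
      length R ! * (x + γ) ^ (ℓ * b) ∎)
      where
      s = ∑ (perms R) (avoiding (U h) (ℓ * b))
      γ≤count : γ ≤ count (U h) R
      γ≤count = <⇒≤ (<ᵇ⇒< γ _ (subst T (sym eq) tt))
      x+γ≡ : x + γ ≡ b * γ
      x+γ≡ = trans (+-comm x γ) γ+x≡
      x+γ≢0 : x + γ ≢ 0
      x+γ≢0 z = ≢-nonZero⁻¹ γ (m+n≡0⇒n≡0 x z)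
      shuffle₁ : ∀ a b c → a * b * c ≡ a * c * b
      shuffle₁ = solve-∀
      shuffle₂ : ∀ a b c → a * b * c ≡ b * (c * a)
      shuffle₂ = solve-∀

  -- A union bound over the |R| positions. The state at a position is determined by the elements
  -- already read, and given these the rest is uniform, so `∑-alarm` applies to it.
  ∑-alarms : ∀ b ℓ γ .{{_ : NonZero γ}} h R → length R ≤ b * γ →
    ∑ (perms R) (alarms (ℓ * b) γ h) * 2 ^ ℓ ≤ length R * length R !
  ∑-alarms b ℓ γ h R₀ = go (length R₀) h R₀ refl
    where
    open ≤-Reasoning
    a = ℓ * b
    later : S → List A → ℕ
    later h [] = 0
    later h (e ∷ σ) = alarms a γ (next h e) σ
    split : ∀ h σ → alarms a γ h σ ≤ alarm a γ h σ + later h σ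
    split h [] = z≤n
    split h (e ∷ σ) = ≤-refl
    go : ∀ r h R → length R ≡ r → length R ≤ b * γ → ∑ (perms R) (alarms a γ h) * 2 ^ ℓ ≤ length R * length R !
    go zero h [] refl _ = z≤n
    go (suc r) h R@(x ∷ xs) eq R≤ = begin
      ∑ (perms R) (alarms a γ h) * 2 ^ ℓ
        ≤⟨ *-monoˡ-≤ (2 ^ ℓ) (∑-mono (perms R) λ σ _ → split h σ) ⟩
      ∑ (perms R) (λ σ → alarm a γ h σ + later h σ) * 2 ^ ℓ
        ≡⟨ cong (_* 2 ^ ℓ) (∑-+ (perms R) (alarm a γ h) (later h)) ⟩
      (∑ (perms R) (alarm a γ h) + ∑ (perms R) (later h)) * 2 ^ ℓ
        ≡⟨ *-distribʳ-+ (2 ^ ℓ) (∑ (perms R) (alarm a γ h)) (∑ (perms R) (later h)) ⟩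
      ∑ (perms R) (alarm a γ h) * 2 ^ ℓ + ∑ (perms R) (later h) * 2 ^ ℓ
        ≤⟨ +-mono-≤ (∑-alarm b ℓ γ h R R≤) (∑-perms-step x xs (later h) (λ _ → 1) (2 ^ ℓ) (r * r !) tails) ⟩
      length R ! + ∑ R (λ _ → 1) * (r * r !)
        ≡⟨ cong₂ (λ k l → k ! + l * (r * r !)) eq (trans (sym (length-∑ R)) eq) ⟩
      suc r * r ! + suc r * (r * r !)
        ≡⟨ *-distribˡ-+ (suc r) (r !) (r * r !) ⟨
      suc r * (suc r * r !)
        ≡⟨ cong (λ k → k * k !) eq ⟨
      length R * length R ! ∎
      where
      tail-length : ∀ {y R′} → (y , R′) ∈ picks R → length R′ ≡ r
      tail-length p = trans (pick-tail {x = x} p) (suc-injective eq)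
      tails : ∀ y R′ → (y , R′) ∈ picks R → ∑ (perms R′) (alarms a γ (next h y)) * 2 ^ ℓ ≤ 1 * (r * r !)
      tails y R′ p = begin
        ∑ (perms R′) (alarms a γ (next h y)) * 2 ^ ℓ
          ≤⟨ go r (next h y) R′ (tail-length p)
               (≤-trans (n≤1+n _) (≤-trans (≤-reflexive (sym (length-pick R p))) R≤)) ⟩
        length R′ * length R′ !   ≡⟨ cong (λ l → l * l !) (tail-length p) ⟩
        r * r !                   ≡⟨ *-identityˡ _ ⟨
        1 * (r * r !) ∎

-- The sparsifier

underfull : List (Edge n) → Edge n → Bool
underfull H e = ends (deg H) e ≤ᵇ 12

update : List (Edge n) → Edge n → List (Edge n)
update H e = if underfull H e then Pruning.kept (prune (e ∷ H)) else H

-- f bounds the number of future insertions into H.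
record Budget (H : List (Edge n)) (f : ℕ) : Set where
  field
    bounded : All (λ e → ends (deg H) e ≤ 14) H
    proper : All Proper H
    potential : 196 * n + sumSq H ≤ 27 * length H + f
    small : length H + f ≤ 196 * n

budget-[] : Budget {n} [] (196 * n)
budget-[] {n} = record
  { bounded = [] ; proper = []
  ; potential = ≤-reflexive (trans (cong (196 * n +_) (∑-zero (allFin n))) (+-identityʳ _))
  ; small = ≤-refl }

-- The edge brings 27 and costs at most 26, and pruning loses nothing, so the potential gains at
-- least 1. Since it cannot exceed 196 n, f was not 0. In `small`, |H| grows by at most 1 while f
-- falls by 1; this field is also the memory bound for H.
budget-insert : ∀ {H : List (Edge n)} {f e} → Budget H f → Proper e → underfull H e ≡ true →
  ∃ λ f′ → f ≡ suc f′ × Budget (Pruning.kept (prune (e ∷ H))) f′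
budget-insert {n} {H} {f} {e} B proper-e light = spend f potential′ small
  where
  open Budget B
  open Pruning (prune (e ∷ H)) renaming (bounded to kept-bounded)
  open ≤-Reasoning
  K = 196 * n
  gap : 2 * ends (deg H) e + 2 ≤ 26
  gap = +-monoˡ-≤ 2 (*-monoʳ-≤ 2 (≤ᵇ⇒≤ (ends (deg H) e) 12 (subst T (sym light) tt)))
  lem₁ : ∀ k s r l → (k + s) + (27 * suc l + r) ≡ (k + r) + (27 * l + (s + 27))
  lem₁ = solve-∀
  lem₂ : ∀ l g s f → 27 * g + (s + 26) + (27 * l + f) ≡ (27 * g + f) + (27 * l + s + 26)
  lem₂ = solve-∀
  lem₃ : ∀ k r l s → suc (k + r) + (27 * l + s + 26) ≡ (k + s) + (27 * suc l + r)
  lem₃ = solve-∀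
  lem₄ : ∀ k s g t → k + s + (g + t) ≡ g + t + (k + s)
  lem₄ = solve-∀
  potential′ : suc (K + sumSq kept) ≤ 27 * length kept + f
  potential′ = +-cancelʳ-≤ (27 * length H + sumSq H + 26) _ _ (begin
    suc (K + sumSq kept) + (27 * length H + sumSq H + 26)   ≡⟨ lem₃ K (sumSq kept) (length H) (sumSq H) ⟩
    (K + sumSq H) + (27 * suc (length H) + sumSq kept)      ≤⟨ +-mono-≤ potential (gain (proper-e ∷ proper)) ⟩
    (27 * length H + f) + (27 * length kept + sumSq (e ∷ H))
      ≡⟨ cong (λ z → (27 * length H + f) + (27 * length kept + z)) (sumSq-insert {e = e} {G = e ∷ H} {H = H} proper-e (λ v → refl)) ⟩
    (27 * length H + f) + (27 * length kept + (sumSq H + (2 * ends (deg H) e + 2)))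
      ≤⟨ +-monoʳ-≤ (27 * length H + f) (+-monoʳ-≤ (27 * length kept) (+-monoʳ-≤ (sumSq H) gap)) ⟩
    (27 * length H + f) + (27 * length kept + (sumSq H + 26)) ≡⟨ +-comm (27 * length H + f) _ ⟩
    27 * length kept + (sumSq H + 26) + (27 * length H + f)   ≡⟨ lem₂ (length H) (length kept) (sumSq H) f ⟩
    27 * length kept + f + (27 * length H + sumSq H + 26) ∎)
  spend : ∀ f → suc (K + sumSq kept) ≤ 27 * length kept + f → length H + f ≤ K → ∃ λ f′ → f ≡ suc f′ × Budget kept f′
  spend zero p q = contradiction (begin
    suc (K + sumSq kept)     ≤⟨ p ⟩
    27 * length kept + 0     ≡⟨ +-identityʳ _ ⟩
    27 * length kept         ≤⟨ potential≤ kept ⟩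
    sumSq kept + K           ≡⟨ +-comm (sumSq kept) K ⟩
    K + sumSq kept ∎) (n≮n _)
  spend (suc f′) p q = f′ , refl , record
    { bounded = kept-bounded
    ; proper = All-resp-⊆ kept⊆ (proper-e ∷ proper)
    ; potential = s≤s⁻¹ (≤-trans p (≤-reflexive (+-suc _ f′)))
    ; small = ≤-trans (+-monoˡ-≤ f′ (length-mono-≤ kept⊆)) (≤-trans (≤-reflexive (sym (+-suc (length H) f′))) q) }

-- A copy of the algorithm waits for a window of α elements without an insertion into H,
-- and from then on collects underfull edges in X.
record Copy (n : ℕ) : Set where
  constructor copy
  field
    window wait : ℕ
    sparse extra : List (Edge n)

open Copy

advance : ℕ → Copy n → Edge n → Copy n
advance γ (copy α zero H X) e = copy α zero H (if underfull H e ∧ (length X <ᵇ γ) then e ∷ X else X)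
advance γ (copy α (suc c) H X) e =
  if underfull H e then copy α α (update H e) X else copy α c H X

start : ℕ → Copy n
start α = copy α α [] []

record Sound (P : Edge n → Set) (γ : ℕ) (s : Copy n) : Set where
  field
    fuel : ℕ
    budget : Budget (sparse s) fuel
    sparse-P : All P (sparse s)
    extra-P : All P (extra s)
    extra≤ : length (extra s) ≤ γ
    wait≤ : wait s ≤ window s

sound-start : ∀ (P : Edge n → Set) γ α → Sound P γ (start α)
sound-start P γ α = record
  { fuel = _ ; budget = budget-[] ; sparse-P = [] ; extra-P = [] ; extra≤ = z≤n ; wait≤ = ≤-refl }

<ᵇ-true : ∀ {m n} → (m <ᵇ n) ≡ true → m < n
<ᵇ-true {m} {n} p = <ᵇ⇒< m n (subst T (sym p) tt)

<ᵇ-false : ∀ {m n} → (m <ᵇ n) ≡ false → n ≤ m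
<ᵇ-false p = ≮⇒≥ λ q → subst T p (<⇒<ᵇ q)

sound-advance : ∀ {P : Edge n → Set} {γ s e} → Proper e → P e → Sound P γ s → Sound P γ (advance γ s e)
sound-advance {γ = γ} {copy α zero H X} {e} pr pe S with underfull H e | length X <ᵇ γ in room
... | true | true = record { Sound S ; extra-P = pe ∷ Sound.extra-P S ; extra≤ = <ᵇ-true room }
... | true | false = S
... | false | _ = S
sound-advance {γ = γ} {copy α (suc c) H X} {e} pr pe S with underfull H e in light
... | false = record { Sound S ; wait≤ = <⇒≤ (Sound.wait≤ S) }
... | true = let (f′ , _ , b) = budget-insert (Sound.budget S) pr light in record
  { fuel = f′ ; budget = b ; sparse-P = All-resp-⊆ (Pruning.kept⊆ (prune (e ∷ H))) (pe ∷ Sound.sparse-P S)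
  ; extra-P = Sound.extra-P S ; extra≤ = Sound.extra≤ S ; wait≤ = ≤-refl }

open module Sparsifier {n} = Monitor {List (Edge n)} {Edge n} underfull update public

run : ℕ → Copy n → List (Edge n) → Copy n
run γ = foldl (advance γ)

avoiding-prefix : ∀ (U : A → Bool) pre σ → All (λ e → U e ≡ false) pre → avoiding U (length pre) (pre ++ σ) ≡ 1
avoiding-prefix U [] σ [] = refl
avoiding-prefix U (e ∷ pre) σ (p ∷ ps) =
  trans (cong (λ b → if b then 0 else avoiding U (length pre) (pre ++ σ)) p) (avoiding-prefix U pre σ ps)

no-alarm : ∀ a γ (H : List (Edge n)) σ → alarms a γ H σ ≡ 0 → avoiding (underfull H) a σ ≡ 1 → count (underfull H) σ ≤ γ
no-alarm a γ H [] z av = z≤n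
no-alarm a γ H σ@(e ∷ σ′) z av = case bool (γ <ᵇ count (underfull H) σ) of λ where
  (inj₁ p) → contradiction (trans (sym av) (trans (cong (λ b → if b then avoiding (underfull H) a σ else 0) (sym p)) (m+n≡0⇒m≡0 _ z))) λ ()
  (inj₂ p) → <ᵇ-false p

alarms-skip : ∀ a γ (H : List (Edge n)) pre σ → All (λ e → underfull H e ≡ false) pre →
  alarms a γ H (pre ++ σ) ≡ 0 → alarms a γ H σ ≡ 0
alarms-skip a γ H [] σ [] z = z
alarms-skip a γ H (e ∷ pre) σ (p ∷ ps) z = alarms-skip a γ H pre σ ps
  (trans (cong (λ b → alarms a γ (if b then Pruning.kept (prune (e ∷ H)) else H) (pre ++ σ)) (sym p))
         (m+n≡0⇒n≡0 (alarm a γ H (e ∷ pre ++ σ)) z))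

-- H no longer changes, so the underfull edges to come are a fixed set; by assumption all of them
-- fit into X, and the test against γ never turns one away.
collect : ∀ γ α (H X : List (Edge n)) σ → length X + count (underfull H) σ ≤ γ →
  let s = run γ (copy α 0 H X) σ in
  sparse s ≡ H × (∀ {e} → e ∈ X → e ∈ extra s) × (∀ {e} → e ∈ σ → underfull H e ≡ true → e ∈ extra s)
collect γ α H X [] h = refl , id , λ ()
collect γ α H X (e ∷ σ) h with underfull H e in light
... | false = let (p , q , r) = collect γ α H X σ h in
  p , q , λ { (here refl) l → true≢false l light ; (there e∈) l → r e∈ l }
... | true with length X <ᵇ γ in room
...   | true = let (p , q , r) = collect γ α H (e ∷ X) σ (≤-trans (≤-reflexive (sym (+-suc (length X) _))) h) in
  p , q ∘ there , λ { (here refl) l → q (here refl) ; (there e∈) l → r e∈ l }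
...   | false = contradiction h (<⇒≱ (≤-trans (s≤s (<ᵇ-false room)) (≤-trans (s≤s (m≤m+n (length X) _)) (≤-reflexive (sym (+-suc (length X) _))))))

-- The edges of `early` are given up. An edge of `late` is either stored in X or has degree sum at
-- least 13 in the final H.
record Split (σ : List (Edge n)) (s : Copy n) (k : ℕ) : Set where
  field
    early late : List (Edge n)
    σ≡ : σ ≡ early ++ late
    early≤ : length early ≤ k
    bounded : All (λ e → ends (deg (sparse s)) e ≤ 14) (sparse s)
    collected : ∀ {e} → e ∈ late → underfull (sparse s) e ≡ true → e ∈ extra s

split-∷ : ∀ {e : Edge n} {σ s k k′} → suc k ≤ k′ → Split σ s k → Split (e ∷ σ) s k′
split-∷ {e = e} k<k′ S = record
  { early = e ∷ early ; late = late ; σ≡ = cong (e ∷_) σ≡ ; early≤ = ≤-trans (s≤s early≤) k<k′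
  ; bounded = bounded ; collected = collected }
  where open Split S

-- The list `pre` is the part of the current window already read, all without insertion. Silence is
-- assumed from its start, because the alarm to be used is the one at the beginning of the window,
-- where the sparsifier was already H. An insertion spends one unit of f and resets the wait to α,
-- whence f * α + c.
run-split : ∀ γ α (σ : List (Edge n)) c H f pre → Budget H f → All Proper σ →
  All (λ e → underfull H e ≡ false) pre → length pre + c ≡ α → alarms α γ H (pre ++ σ) ≡ 0 →
  Split σ (run γ (copy α c H []) σ) (f * α + c)
run-split γ α σ zero H f pre B _ ps refl z = record
  { early = [] ; late = σ ; σ≡ = refl ; early≤ = z≤n
  ; bounded = subst (λ G → All (λ e → ends (deg G) e ≤ 14) G) (sym same) (Budget.bounded B)
  ; collected = λ e∈ l → stored e∈ (subst (λ G → underfull G _ ≡ true) same l) }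
  where
  few : count (underfull H) (pre ++ σ) ≤ γ
  few = no-alarm α γ H (pre ++ σ) z (trans (cong (λ a → avoiding (underfull H) a (pre ++ σ)) (+-identityʳ (length pre))) (avoiding-prefix (underfull H) pre σ ps))
  result = collect γ α H [] σ (≤-trans (≤-trans (m≤n+m _ _) (≤-reflexive (sym (∑-++ pre σ (ind ∘ underfull H))))) few)
  same = proj₁ result
  stored = proj₂ (proj₂ result)
-- The stream ends during the wait, and everything read counts as early.
run-split γ α [] (suc c) H f pre B _ ps len z = record
  { early = [] ; late = [] ; σ≡ = refl ; early≤ = z≤n ; bounded = Budget.bounded B ; collected = λ () }
run-split γ α (e ∷ σ) (suc c) H f pre B (pr ∷ prs) ps len z with underfull H e in light
... | false = split-∷ (≤-reflexive (sym (+-suc (f * α) c)))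
  (run-split γ α σ c H f (pre ++ e ∷ []) B prs (All.++⁺ ps (light ∷ [])) len′
    (trans (cong (alarms α γ H) (++-assoc pre (e ∷ []) σ)) z))
  where
  len′ : length (pre ++ e ∷ []) + c ≡ α
  len′ = trans (cong (_+ c) (length-++ pre)) (trans (+-assoc (length pre) 1 c) len)
... | true = let (f′ , f≡ , B′) = budget-insert B pr light in
  split-∷ (shorter f′ f≡)
    (run-split γ α σ α (Pruning.kept (prune (e ∷ H))) f′ [] B′ prs [] refl
      (subst (λ G → alarms α γ G σ ≡ 0) update≡
        (m+n≡0⇒n≡0 (alarm α γ H (e ∷ σ)) (alarms-skip α γ H pre (e ∷ σ) ps z))))
  where
  update≡ : update H e ≡ Pruning.kept (prune (e ∷ H))
  update≡ = cong (λ b → if b then Pruning.kept (prune (e ∷ H)) else H) light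
  shorter : ∀ f′ → f ≡ suc f′ → suc (f′ * α + α) ≤ f * α + suc c
  shorter f′ refl = ≤-trans (s≤s (≤-trans (≤-reflexive (+-comm (f′ * α) α)) (m≤m+n (α + f′ * α) c))) (≤-reflexive (sym (+-suc (α + f′ * α) c)))

-- Filtering

boolFilter-accept : ∀ (p : A → Bool) {x} xs → p x ≡ true → boolFilter p (x ∷ xs) ≡ x ∷ boolFilter p xs
boolFilter-accept p {x} xs e = cong (λ b → if b then x ∷ boolFilter p xs else boolFilter p xs) e

boolFilter-reject : ∀ (p : A → Bool) {x} xs → p x ≡ false → boolFilter p (x ∷ xs) ≡ boolFilter p xs
boolFilter-reject p {x} xs e = cong (λ b → if b then x ∷ boolFilter p xs else boolFilter p xs) e

boolFilter-⊆ : ∀ (p : A → Bool) xs → boolFilter p xs ⊆ xs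
boolFilter-⊆ p [] = []
boolFilter-⊆ p (x ∷ xs) with p x
... | true = refl ∷ boolFilter-⊆ p xs
... | false = x ∷ʳ boolFilter-⊆ p xs

boolFilter-all : ∀ (p : A → Bool) xs → All (λ x → p x ≡ true) (boolFilter p xs)
boolFilter-all p [] = []
boolFilter-all p (x ∷ xs) with p x in e
... | true = e ∷ boolFilter-all p xs
... | false = boolFilter-all p xs

∈-boolFilter⁺ : ∀ (p : A → Bool) {x xs} → x ∈ xs → p x ≡ true → x ∈ boolFilter p xs
∈-boolFilter⁺ p {xs = y ∷ ys} (here refl) e = subst (_ ∈_) (sym (boolFilter-accept p ys e)) (here refl)
∈-boolFilter⁺ p {xs = y ∷ xs} (there x∈) e with p y
... | true = there (∈-boolFilter⁺ p x∈ e)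
... | false = ∈-boolFilter⁺ p x∈ e

boolFilter-++ : ∀ (p : A → Bool) xs ys → boolFilter p (xs ++ ys) ≡ boolFilter p xs ++ boolFilter p ys
boolFilter-++ p [] ys = refl
boolFilter-++ p (x ∷ xs) ys with p x
... | true = cong (x ∷_) (boolFilter-++ p xs ys)
... | false = boolFilter-++ p xs ys

boolFilter-↭ : ∀ (p : A → Bool) {xs ys} → xs ↭ ys → boolFilter p xs ↭ boolFilter p ys
boolFilter-↭ p ↭.refl = ↭-refl
boolFilter-↭ p (↭.prep x r) with p x
... | true = ↭-prep x (boolFilter-↭ p r)
... | false = boolFilter-↭ p r
boolFilter-↭ p (↭.swap x y r) with p x | p y
... | true | true = ↭-swap x y (boolFilter-↭ p r)
... | true | false = ↭-prep x (boolFilter-↭ p r)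
... | false | true = ↭-prep y (boolFilter-↭ p r)
... | false | false = boolFilter-↭ p r
boolFilter-↭ p (↭.trans r s) = ↭-trans (boolFilter-↭ p r) (boolFilter-↭ p s)

Matching-⊆ : ∀ {M N : List (Edge n)} → M ⊆ N → Matching N → Matching M
Matching-⊆ [] [] = []
Matching-⊆ (y ∷ʳ s) (d ∷ ds) = Matching-⊆ s ds
Matching-⊆ (refl ∷ s) (d ∷ ds) = All-resp-⊆ s d ∷ Matching-⊆ s ds

Matching-↭ : ∀ {M N : List (Edge n)} → M ↭ N → Matching M → Matching N
Matching-↭ ↭.refl m = m
Matching-↭ (↭.prep x r) (d ∷ ds) = All-resp-↭ r d ∷ Matching-↭ r ds
Matching-↭ (↭.swap x y r) ((xy ∷ dx) ∷ dy ∷ ds) =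
  (Disjoint-sym {e = x} {y} xy ∷ All-resp-↭ r dy) ∷ All-resp-↭ r dx ∷ Matching-↭ r ds
Matching-↭ (↭.trans r s) m = Matching-↭ s (Matching-↭ r m)

-- Maximum matchings

∈-sublists⁺ : ∀ {xs ys : List A} → xs ⊆ ys → xs ∈ sublists ys
∈-sublists⁺ [] = here refl
∈-sublists⁺ {ys = y ∷ ys} (y ∷ʳ s) = ∈-++⁺ʳ (map (y ∷_) (sublists ys)) (∈-sublists⁺ s)
∈-sublists⁺ (refl ∷ s) = ∈-++⁺ˡ (∈-map⁺ _ (∈-sublists⁺ s))

∈-sublists⁻ : ∀ {xs : List A} ys → xs ∈ sublists ys → xs ⊆ ys
∈-sublists⁻ [] (here refl) = []
∈-sublists⁻ (y ∷ ys) p with ∈-++⁻ (map (y ∷_) (sublists ys)) p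
... | inj₂ q = y ∷ʳ ∈-sublists⁻ ys q
... | inj₁ q with ∈-map⁻ (y ∷_) q
...   | zs , zs∈ , refl = refl ∷ ∈-sublists⁻ ys zs∈

matchings : List (Edge n) → List (List (Edge n))
matchings Q = boolFilter isMatchingB (sublists Q)

maxMatching : List (Edge n) → List (Edge n)
maxMatching Q = argmax length [] (matchings Q)

maxMatching-is : ∀ (Q : List (Edge n)) → maxMatching Q ⊆ Q × Matching (maxMatching Q)
maxMatching-is Q with argmax-sel length [] (matchings Q)
... | inj₁ e = subst (λ M → M ⊆ Q × Matching M) (sym e) (minimum Q , [])
... | inj₂ p = ∈-sublists⁻ Q (Any-resp-⊆ (boolFilter-⊆ isMatchingB (sublists Q)) p)
             , isMatchingB⇒Matching (maxMatching Q) (All.lookup (boolFilter-all isMatchingB (sublists Q)) p)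

maxMatching-max : ∀ {Q M : List (Edge n)} → M ⊆ Q → Matching M → length M ≤ length (maxMatching Q)
maxMatching-max {Q = Q} s m = All.lookup (f[xs]≤f[argmax] [] (matchings Q)) (∈-boolFilter⁺ isMatchingB (∈-sublists⁺ s) (Matching⇒isMatchingB m))

μ≡length-maxMatching : ∀ (E : List (Edge n)) → μ E ≡ length (maxMatching E)
μ≡length-maxMatching E = ≤-antisym
  (upper (matchings E) (All.tabulate λ {M} M∈ → maxMatching-max
    (∈-sublists⁻ E (Any-resp-⊆ (boolFilter-⊆ isMatchingB (sublists E)) M∈))
    (isMatchingB⇒Matching M (All.lookup (boolFilter-all isMatchingB (sublists E)) M∈))))
  (lower (∈-boolFilter⁺ isMatchingB (∈-sublists⁺ (proj₁ is)) (Matching⇒isMatchingB (proj₂ is))))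
  where
  is = maxMatching-is E
  upper : ∀ (Ms : List (List (Edge _))) {k} → All (λ M → length M ≤ k) Ms → foldr _⊔_ 0 (map length Ms) ≤ k
  upper [] [] = z≤n
  upper (M ∷ Ms) (p ∷ ps) = ⊔-lub p (upper Ms ps)
  lower : ∀ {Ms : List (List (Edge _))} {M} → M ∈ Ms → length M ≤ foldr _⊔_ 0 (map length Ms)
  lower (here refl) = m≤m⊔n _ _
  lower (there p) = ≤-trans (lower p) (m≤n⊔m _ _)

memberᵉ : List (Edge n) → Edge n → Bool
memberᵉ M e = any (e ==ᵉ_) M

==ᵉ-distinct : ∀ {e f : Edge n} → sameEdge e f ≡ false → (f ==ᵉ e) ≡ false
==ᵉ-distinct {e = e} {f} d with f ==ᵉ e in p
... | false = refl
... | true with ==ᵉ⇒≡ {e = f} p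
...   | refl = true≢false (sameEdge-refl e) d

-- Turns a sublist into a predicate that can be counted along any ordering. Distinctness prevents
-- further occurrences from passing the filter.
filter-memberᵉ : ∀ {M E : List (Edge n)} → M ⊆ E → SimplyDistinct E → boolFilter (memberᵉ M) E ≡ M
filter-memberᵉ [] [] = refl
filter-memberᵉ {M = M} {E = _ ∷ E} (x ∷ʳ s) (d ∷ ds) = trans (boolFilter-reject (memberᵉ M) E (absent (All-resp-⊆ s d))) (filter-memberᵉ s ds)
  where
  absent : ∀ {N} → All (λ f → sameEdge x f ≡ false) N → memberᵉ N x ≡ false
  absent [] = refl
  absent {f ∷ N} (p ∷ ps) = cong₂ _∨_ (∨-falseˡ (x ==ᵉ f) p) (absent ps)
filter-memberᵉ {M = x ∷ M} {x ∷ E} (refl ∷ s) (d ∷ ds) = trans (boolFilter-accept (memberᵉ (x ∷ M)) E (cong (_∨ memberᵉ M x) (==ᵉ-refl x)))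
  (cong (x ∷_) (trans (same E d) (filter-memberᵉ s ds)))
  where
  same : ∀ F → All (λ f → sameEdge x f ≡ false) F → boolFilter (memberᵉ (x ∷ M)) F ≡ boolFilter (memberᵉ M) F
  same [] [] = refl
  same (f ∷ F) (p ∷ ps) rewrite ==ᵉ-distinct {e = x} {f} p with memberᵉ M f
  ... | true = cong (f ∷_) (same F ps)
  ... | false = same F ps

-- The approximation ratio of a successful copy

isCovered : VSet n → Edge n → Bool
isCovered C (a , b) = C a ∨ C b

count-prefix : ∀ (p : A → Bool) (xs ys : List A) k → length xs ≤ k → count p xs ≤ count p (take k (xs ++ ys))
count-prefix p [] ys k h = z≤n
count-prefix p (x ∷ xs) ys (suc k) h = +-monoʳ-≤ (ind (p x)) (count-prefix p xs ys k (s≤s⁻¹ h))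

module _ {E : List (Edge n)} (G : IsBipartiteGraph E) where

  private
    simple = proj₁ G
    side = proj₁ (proj₂ G)

    separates : All (Separates side) E
    separates = All.map (λ { {_ , _} p → p }) (proj₂ (proj₂ G))

  optimal : Edge n → Bool
  optimal = memberᵉ (maxMatching E)

  optimal-filter : boolFilter optimal E ≡ maxMatching E
  optimal-filter = filter-memberᵉ (proj₁ (maxMatching-is E)) (proj₂ simple)

  count-optimal : count optimal E ≡ μ E
  count-optimal = trans (sym (length-boolFilter optimal E)) (trans (cong length optimal-filter) (sym (μ≡length-maxMatching E)))

  -- A cover of μ vertices exists by Kőnig's theorem, and each is on at most n edges. This is what
  -- makes μ large in graphs too dense to be stored.
  edges≤μ*n : length E ≤ μ E * n
  edges≤μ*n with kőnig side (μ E) E separates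
  ... | inj₁ (C , C≤ , cov) = ≤-trans (covered-length C n cov (deg≤n simple)) (*-monoˡ-≤ n C≤)
  ... | inj₂ (M , M⊆ , m , large) = contradiction (≤-trans (maxMatching-max M⊆ m) (≤-reflexive (sym (μ≡length-maxMatching E)))) (<⇒≱ large)

  edges≤n*n : length E ≤ n * n
  edges≤n*n = ≤-trans (covered-length (λ _ → true) {E} n (All.tabulate λ _ → inj₁ refl) (deg≤n simple))
    (*-monoˡ-≤ n (≤-reflexive (trans (∑ᵛ-const {n} 1) (*-identityʳ n))))

  -- The late optimal edges meeting C are disjoint, hence at most |C|. The others are not stored,
  -- hence heavy, and number at most 7|C|/12. Together, (19/20) μ ≤ (19/12) |C|.
  cover-bound : ∀ {σ s k} C → σ ↭ E → Split σ s k → All (Covers C) (sparse s) →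
    (∀ {e} → e ∈ extra s → Covers C e) → 20 * count optimal (take k σ) ≤ μ E → 3 * μ E ≤ 5 * size C
  cover-bound {σ} {s} {k} C σ↭E S H-cov X-cov early-few = *-cancelˡ-≤ 76 (begin
    76 * (3 * μ E)                            ≡⟨ lem₁ (μ E) ⟩
    12 * (19 * μ E)                           ≤⟨ *-monoʳ-≤ 12 19μ≤ ⟩
    12 * (20 * length M′)                     ≡⟨ cong (λ z → 12 * (20 * z)) M′≡ ⟩
    12 * (20 * (length inC + length N))       ≡⟨ lem₂ (length inC) (length N) ⟩
    20 * (12 * length inC + 12 * length N)    ≤⟨ *-monoʳ-≤ 20 (+-mono-≤ (*-monoʳ-≤ 12 inC≤) (uncovered-few C H N H-cov bounded N-proper N-matching N-avoids N-heavy)) ⟩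
    20 * (12 * size C + 7 * size C)           ≡⟨ lem₃ (size C) ⟩
    76 * (5 * size C) ∎)
    where
    open ≤-Reasoning
    open Split S
    H = sparse s
    M′ = boolFilter optimal late
    inC = boolFilter (isCovered C) M′
    N = boolFilter (not ∘ isCovered C) M′
    lem₁ : ∀ m → 76 * (3 * m) ≡ 12 * (19 * m)
    lem₁ = solve-∀
    lem₂ : ∀ a b → 12 * (20 * (a + b)) ≡ 20 * (12 * a + 12 * b)
    lem₂ = solve-∀
    lem₃ : ∀ q → 20 * (12 * q + 7 * q) ≡ 76 * (5 * q)
    lem₃ = solve-∀
    lem₄ : ∀ m → 20 * m ≡ m + 19 * m
    lem₄ = solve-∀
    M′⊆ : M′ ⊆ boolFilter optimal σ
    M′⊆ = subst (M′ ⊆_) (sym (trans (cong (boolFilter optimal) σ≡) (boolFilter-++ optimal early late))) (++⁺ˡ (boolFilter optimal early) ⊆-refl)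
    late⊆E : ∀ {e} → e ∈ late → e ∈ E
    late⊆E e∈ = ∈-resp-↭ σ↭E (subst (_ ∈_) (sym σ≡) (∈-++⁺ʳ early e∈))
    M′-matching : Matching M′
    M′-matching = Matching-⊆ M′⊆ (Matching-↭ (↭-sym (boolFilter-↭ optimal σ↭E))
      (subst Matching (sym optimal-filter) (proj₂ (maxMatching-is E))))
    ∈M′⇒∈late : ∀ {e} → e ∈ M′ → e ∈ late
    ∈M′⇒∈late = Any-resp-⊆ (boolFilter-⊆ optimal late)
    M′-proper : All Proper M′
    M′-proper = All.tabulate λ e∈ → All.lookup (simple⇒Proper simple) (late⊆E (∈M′⇒∈late e∈))
    N⊆ : N ⊆ M′
    N⊆ = boolFilter-⊆ (not ∘ isCovered C) M′
    inC⊆ : inC ⊆ M′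
    inC⊆ = boolFilter-⊆ (isCovered C) M′
    N-proper = All-resp-⊆ N⊆ M′-proper
    N-matching = Matching-⊆ N⊆ M′-matching
    missed : ∀ {e} → not (isCovered C e) ≡ true → Avoids C e
    missed {a , b} p (inj₁ refl) = ∨-falseˡ (C a) (not-true p)
    missed {a , b} p (inj₂ refl) = ∨-falseʳ (C a) (not-true p)
    N-avoids : All (Avoids C) N
    N-avoids = All.map (λ {e} p {x} → missed {e} p {x}) (boolFilter-all (not ∘ isCovered C) M′)
    avoids⇒¬Covers : ∀ {e} → Avoids C e → Covers C e → 13 ≤ ends (deg H) e
    avoids⇒¬Covers av (inj₁ p) = true≢false p (av (inj₁ refl))
    avoids⇒¬Covers av (inj₂ p) = true≢false p (av (inj₂ refl))
    heavy : ∀ {e} → e ∈ late → Avoids C e → 13 ≤ ends (deg H) e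
    heavy {e} e∈ av with underfull H e in light
    ... | true = avoids⇒¬Covers {e} av (X-cov (collected e∈ light))
    ... | false = ≰⇒> λ q → subst T light (≤⇒≤ᵇ q)
    N-heavy : All (λ e → 13 ≤ ends (deg H) e) N
    N-heavy = All.tabulate λ {e} e∈ → heavy (∈M′⇒∈late (Any-resp-⊆ N⊆ e∈)) (λ {x} → All.lookup N-avoids e∈ {x})
    inC≤ : length inC ≤ size C
    inC≤ = ≤-trans (covered-length C 1 (All.map (λ { {a , b} p → ∨-true (C a) p }) (boolFilter-all (isCovered C) M′))
        (λ v → deg-matching≤1 v (All-resp-⊆ inC⊆ M′-proper) (Matching-⊆ inC⊆ M′-matching)))
      (≤-reflexive (*-identityʳ (size C)))
    M′≡ : length M′ ≡ length inC + length N
    M′≡ = trans (sym (count-not (isCovered C) M′)) (trans (+-comm _ (count (isCovered C) M′))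
      (sym (cong₂ _+_ (length-boolFilter (isCovered C) M′) (length-boolFilter (not ∘ isCovered C) M′))))
    μ≡ : μ E ≡ count optimal early + length M′
    μ≡ = trans (sym count-optimal) (trans (sym (∑-↭ (ind ∘ optimal) σ↭E)) (trans (cong (count optimal) σ≡)
      (trans (∑-++ early late (ind ∘ optimal)) (cong (count optimal early +_) (sym (length-boolFilter optimal late))))))
    early-few′ : 20 * count optimal early ≤ μ E
    early-few′ = ≤-trans (*-monoʳ-≤ 20 (≤-trans (count-prefix optimal early late k early≤) (≤-reflexive (cong (count optimal ∘ take k) (sym σ≡))))) early-few
    19μ≤ : 19 * μ E ≤ 20 * length M′
    19μ≤ = +-cancelˡ-≤ (μ E) _ _ (begin
      μ E + 19 * μ E                                   ≡⟨ lem₄ (μ E) ⟨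
      20 * μ E                                         ≡⟨ cong (20 *_) μ≡ ⟩
      20 * (count optimal early + length M′)           ≡⟨ *-distribˡ-+ 20 (count optimal early) (length M′) ⟩
      20 * count optimal early + 20 * length M′        ≤⟨ +-monoˡ-≤ (20 * length M′) early-few′ ⟩
      μ E + 20 * length M′ ∎)

  -- Q need only contain one good copy and lie within E. So the matching can be taken in the union
  -- of all copies, without knowing which of them is good.
  approximation : ∀ {σ s k Q} → σ ↭ E → Split σ s k → (∀ {e} → e ∈ Q → e ∈ E) →
    (∀ {e} → e ∈ sparse s → e ∈ Q) → (∀ {e} → e ∈ extra s → e ∈ Q) →
    20 * count optimal (take k σ) ≤ μ E → 3 * μ E ≤ 5 * length (maxMatching Q)
  approximation {Q = Q} σ↭E S Q⊆E H⊆Q X⊆Q early-few =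
    case kőnig side (length (maxMatching Q)) Q (All.tabulate λ e∈ → All.lookup separates (Q⊆E e∈)) of λ where
      (inj₁ (C , C≤ , cov)) → ≤-trans
        (cover-bound C σ↭E S (All.tabulate λ e∈ → All.lookup cov (H⊆Q e∈)) (λ e∈ → All.lookup cov (X⊆Q e∈)) early-few)
        (*-monoʳ-≤ 5 C≤)
      (inj₂ (M , M⊆ , m , large)) → contradiction (maxMatching-max M⊆ m) (<⇒≱ large)

isMatchingOf-maxMatching : ∀ {Q E : List (Edge n)} → (∀ {e} → e ∈ Q → e ∈ E) → isMatchingOf E (maxMatching Q) ≡ true
isMatchingOf-maxMatching {Q = Q} {E} Q⊆E = cong₂ _∧_
  (All⇒all (λ e → edgeOf e E) (All.tabulate λ {e} e∈ → present e (Q⊆E (Any-resp-⊆ (proj₁ is) e∈))))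
  (Matching⇒isMatchingB (proj₂ is))
  where
  is = maxMatching-is Q
  present : ∀ e {F} → e ∈ F → edgeOf e F ≡ true
  present e {_ ∷ F} (here refl) = cong (_∨ edgeOf e F) (sameEdge-refl e)
  present e {f ∷ F} (there p) = trans (cong (sameEdge e f ∨_) (present e p)) (∨-zeroʳ _)

three-fifths : ∀ {m k} → 3 * m ≤ 5 * k → (((ℤ.+ 3 ℚ./ 5) ℚ.- 0ℚ) ℚ.* ℕtoℚ m ℚ.≤ᵇ ℕtoℚ k) ≡ true
three-fifths {m} {k} h = Equivalence.to T-≡ (ℚ.≤⇒≤ᵇ (ℚ.toℚᵘ-cancel-≤ (begin
  toℚᵘ ((ℤ.+ 3 ℚ./ 5) ℚ.* ℕtoℚ m)          ≃⟨ ℚ.toℚᵘ-homo-* (ℤ.+ 3 ℚ./ 5) (ℕtoℚ m) ⟩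
  toℚᵘ (ℤ.+ 3 ℚ./ 5) ℚᵘ.* toℚᵘ (ℕtoℚ m)    ≃⟨ ℚᵘ.*-congˡ {toℚᵘ (ℤ.+ 3 ℚ./ 5)} (ℚ.toℚᵘ-fromℚᵘ (mkℚᵘ (ℤ.+ m) 0)) ⟩
  mkℚᵘ (ℤ.+ 3) 4 ℚᵘ.* mkℚᵘ (ℤ.+ m) 0       ≤⟨ *≤* cross ⟩
  mkℚᵘ (ℤ.+ k) 0                           ≃⟨ ℚ.toℚᵘ-fromℚᵘ (mkℚᵘ (ℤ.+ k) 0) ⟨
  toℚᵘ (ℕtoℚ k) ∎)))
  where
  open ℚᵘ.≤-Reasoning
  cross : (ℤ.+ 3 ℤ.* ℤ.+ m) ℤ.* ℤ.+ 1 ℤ.≤ ℤ.+ k ℤ.* ℤ.+ 5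
  cross = subst₂ ℤ._≤_ (trans (ℤ.pos-* 3 m) (sym (ℤ.*-identityʳ _)))
    (trans (cong ℤ.+_ (*-comm 5 k)) (ℤ.pos-* k 5)) (ℤ.+≤+ h)

-- Prefix codes

record Code (A : Set) : Set where
  field
    enc : A → List Bool
    dec : List Bool → Maybe (A × List Bool)
    dec-enc : ∀ a r → dec (enc a ++ r) ≡ just (a , r)

open Code

digits : ℕᵇ → ℕ
digits ℕᵇ.zero = 0
digits 2[1+ x ] = suc (digits x)
digits 1+[2 x ] = suc (digits x)

2^digits≤ : ∀ x → 2 ^ digits x ≤ suc (ℕᵇ.toℕ x)
2^digits≤ ℕᵇ.zero = ≤-refl
2^digits≤ 2[1+ x ] = ≤-trans (*-monoʳ-≤ 2 (2^digits≤ x)) (n≤1+n _)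
2^digits≤ 1+[2 x ] = ≤-trans (*-monoʳ-≤ 2 (2^digits≤ x)) (≤-reflexive (lem (ℕᵇ.toℕ x)))
  where
  lem : ∀ t → 2 * suc t ≡ suc (suc (2 * t))
  lem = solve-∀

-- Each digit is announced by `true` and the numeral is closed by `false`, which makes the code
-- self-delimiting.
binaryCode : Code ℕᵇ
binaryCode .enc ℕᵇ.zero = false ∷ []
binaryCode .enc 2[1+ x ] = true ∷ false ∷ binaryCode .enc x
binaryCode .enc 1+[2 x ] = true ∷ true ∷ binaryCode .enc x
binaryCode .dec [] = nothing
binaryCode .dec (false ∷ r) = just (ℕᵇ.zero , r)
binaryCode .dec (true ∷ []) = nothing
binaryCode .dec (true ∷ false ∷ r) = Maybe.map (λ (x , r′) → 2[1+ x ] , r′) (binaryCode .dec r)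
binaryCode .dec (true ∷ true ∷ r) = Maybe.map (λ (x , r′) → 1+[2 x ] , r′) (binaryCode .dec r)
binaryCode .dec-enc ℕᵇ.zero r = refl
binaryCode .dec-enc 2[1+ x ] r rewrite binaryCode .dec-enc x r = refl
binaryCode .dec-enc 1+[2 x ] r rewrite binaryCode .dec-enc x r = refl

binary-length : ∀ x → length (enc binaryCode x) ≡ 1 + 2 * digits x
binary-length ℕᵇ.zero = refl
binary-length 2[1+ x ] = trans (cong (2 +_) (binary-length x)) (lem (digits x))
  where
  lem : ∀ d → 2 + (1 + 2 * d) ≡ 1 + 2 * suc d
  lem = solve-∀
binary-length 1+[2 x ] = trans (cong (2 +_) (binary-length x)) (lem (digits x))
  where
  lem : ∀ d → 2 + (1 + 2 * d) ≡ 1 + 2 * suc d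
  lem = solve-∀

via : (f : A → B) (g : B → Maybe A) → (∀ a → g (f a) ≡ just a) → Code B → Code A
via f g gf c .enc a = enc c (f a)
via f g gf c .dec bits = dec c bits >>= λ (b , r) → Maybe.map (_, r) (g b)
via f g gf c .dec-enc a r rewrite dec-enc c (f a) r | gf a = refl

natCode : Code ℕ
natCode = via ℕᵇ.fromℕ (just ∘ ℕᵇ.toℕ) (cong just ∘ ℕᵇ.toℕ-fromℕ) binaryCode

2^-cancel-≤ : ∀ {a b} → 2 ^ a ≤ 2 ^ b → a ≤ b
2^-cancel-≤ {a} {b} h = ≮⇒≥ λ b<a → <⇒≱ (^-monoʳ-< 2 (s≤s (s≤s z≤n)) b<a) h

nat-length : ∀ k w → k < 2 ^ w → length (enc natCode k) ≤ 1 + 2 * w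
nat-length k w h = ≤-trans (≤-reflexive (binary-length (ℕᵇ.fromℕ k))) (s≤s (*-monoʳ-≤ 2 (2^-cancel-≤ {digits (ℕᵇ.fromℕ k)} {w} (≤-trans (2^digits≤ (ℕᵇ.fromℕ k))
  (≤-trans (≤-reflexive (cong suc (ℕᵇ.toℕ-fromℕ k))) h)))))

toFin : ∀ n → ℕ → Maybe (Fin n)
toFin n k with k <? n
... | yes p = just (fromℕ< p)
... | no _ = nothing

toFin-toℕ : ∀ (i : Fin n) → toFin n (toℕ i) ≡ just i
toFin-toℕ {n} i with toℕ i <? n
... | yes p = cong just (Fin.fromℕ<-toℕ i p)
... | no ¬p = contradiction (Fin.toℕ<n i) ¬p

finCode : Code (Fin n)
finCode {n} = via toℕ (toFin n) toFin-toℕ natCode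

pairCode : Code A → Code B → Code (A × B)
pairCode c d .enc (a , b) = enc c a ++ enc d b
pairCode c d .dec bits = dec c bits >>= λ (a , r) → Maybe.map (λ (b , r′) → (a , b) , r′) (dec d r)
pairCode c d .dec-enc (a , b) r
  rewrite ++-assoc (enc c a) (enc d b) r | dec-enc c a (enc d b ++ r) | dec-enc d b r = refl

module _ (c : Code A) where

  encList : List A → List Bool
  encList [] = false ∷ []
  encList (x ∷ xs) = true ∷ enc c x ++ encList xs

  -- Every element consumes a bit, so the length of the input is enough fuel.
  decList : ℕ → List Bool → Maybe (List A × List Bool)
  decList zero bits = nothing
  decList (suc k) [] = nothing
  decList (suc k) (false ∷ r) = just ([] , r)
  decList (suc k) (true ∷ r) = dec c r >>= λ (x , r′) → Maybe.map (λ (xs , r″) → x ∷ xs , r″) (decList k r′)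

  decList-encList : ∀ k xs r → length xs < k → decList k (encList xs ++ r) ≡ just (xs , r)
  decList-encList (suc k) [] r h = refl
  decList-encList (suc k) (x ∷ xs) r h
    rewrite ++-assoc (enc c x) (encList xs) r | dec-enc c x (encList xs ++ r)
          | decList-encList k xs r (s≤s⁻¹ h) = refl

  length<encList : ∀ xs r → length xs < length (encList xs ++ r)
  length<encList [] r = s≤s z≤n
  length<encList (x ∷ xs) r = s≤s (≤-trans (length<encList xs r)
    (≤-trans (m≤n+m _ (length (enc c x)))
      (≤-reflexive (trans (sym (length-++ (enc c x))) (cong length (sym (++-assoc (enc c x) (encList xs) r)))))))

  listCode : Code (List A)
  listCode .enc = encList
  listCode .dec bits = decList (length bits) bits
  listCode .dec-enc xs r = decList-encList (length (encList xs ++ r)) xs r (length<encList xs r)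

  list-length : ∀ w xs → All (λ x → length (enc c x) ≤ w) xs → length (encList xs) ≤ 1 + length xs * (1 + w)
  list-length w [] [] = ≤-refl
  list-length w (x ∷ xs) (p ∷ ps) = begin
    suc (length (enc c x ++ encList xs))             ≡⟨ cong suc (length-++ (enc c x)) ⟩
    suc (length (enc c x) + length (encList xs))     ≤⟨ s≤s (+-mono-≤ p (list-length w xs ps)) ⟩
    suc (w + (1 + length xs * (1 + w)))              ≡⟨ lem w (length xs * (1 + w)) ⟩
    1 + (1 + w + length xs * (1 + w)) ∎
    where
    open ≤-Reasoning
    lem : ∀ w z → suc (w + (1 + z)) ≡ 1 + (1 + w + z)
    lem = solve-∀

edgeCode : Code (Edge n)
edgeCode = pairCode finCode finCode

copyCode : Code (Copy n)
copyCode = via (λ s → (window s , wait s) , (sparse s , extra s)) (λ ((α , c) , (H , X)) → just (copy α c H X)) (λ _ → refl)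
  (pairCode (pairCode natCode natCode) (pairCode (listCode edgeCode) (listCode edgeCode)))

-- Streaming algorithms with structured states

module Encoded (State : ℕ → Set) (code : ∀ {n} → Code (State n)) (initial : ∀ n → State n)
  (next : ∀ {n} → State n → Edge n → State n) (output : ∀ {n} → State n → List (Edge n)) where

  algorithm : StreamAlg
  algorithm .init n = enc code (initial n)
  -- The default is met only on bit strings that encode no state; every memory reached is an
  -- encoding.
  algorithm .step n bits e = maybe′ (λ (s , _) → enc code (next s e)) [] (dec code bits)
  algorithm .out n bits = maybe′ (output ∘ proj₁) [] (dec code bits)

  private
    decode : ∀ (s : State n) → dec code (enc code s) ≡ just (s , [])
    decode s = trans (cong (dec code) (sym (++-identityʳ (enc code s)))) (dec-enc code s [])

    step-enc : ∀ (s : State n) e → step algorithm n (enc code s) e ≡ enc code (next s e)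
    step-enc s e = cong (maybe′ (λ (s , _) → enc code (next s e)) []) (decode s)

    foldl-enc : ∀ (s : State n) σ → foldl (step algorithm n) (enc code s) σ ≡ enc code (foldl next s σ)
    foldl-enc s [] = refl
    foldl-enc {n} s (e ∷ σ) = trans (cong (λ b → foldl (step algorithm n) b σ) (step-enc s e)) (foldl-enc (next s e) σ)

  runAlg-algorithm : ∀ n (σ : List (Edge n)) → runAlg algorithm n σ ≡ output (foldl next (initial n) σ)
  runAlg-algorithm n σ = trans (cong (out algorithm n) (foldl-enc (initial n) σ))
    (cong (maybe′ (output ∘ proj₁) []) (decode (foldl next (initial n) σ)))

  module _ (I : State n → Set) (P : Edge n → Set) (preserve : ∀ {s e} → P e → I s → I (next s e)) where

    foldl-invariant : ∀ {s σ} → All P σ → I s → I (foldl next s σ)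
    foldl-invariant [] i = i
    foldl-invariant (p ∷ ps) i = foldl-invariant ps (preserve p i)

    memory-invariant : ∀ {b s σ} → (∀ {s} → I s → length (enc code s) ≤ b) → All P σ → I s →
      All (λ m → length m ≤ b) (scanl (step algorithm n) (enc code s) σ)
    memory-invariant short [] i = short i ∷ []
    memory-invariant {b} {s} {e ∷ σ} short (p ∷ ps) i = short i ∷
      subst (λ m → All (λ m → length m ≤ b) (scanl (step algorithm n) m σ)) (sym (step-enc s e))
        (memory-invariant short ps (preserve p i))

-- The parameters of the algorithm

ℒ : ℕ → ℕ
ℒ n = 1 + ⌊log₂ n ⌋

n<2^ℒ : ∀ n → n < 2 ^ ℒ n
n<2^ℒ = <-rec _ go
  where
  go : ∀ n → (∀ {m} → m < n → m < 2 ^ ℒ m) → n < 2 ^ ℒ n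
  go 0 rec = s≤s z≤n
  go 1 rec = ≤-refl
  go n@(suc (suc k)) rec = begin-strict
    n                            ≤⟨ halves n ⟩
    suc (2 * ⌊ n /2⌋)            <⟨ s≤s (≤-reflexive (sym (+-suc ⌊ n /2⌋ _))) ⟩
    2 * suc ⌊ n /2⌋              ≤⟨ *-monoʳ-≤ 2 (rec {⌊ n /2⌋} (⌊n/2⌋<n (suc k))) ⟩
    2 * 2 ^ ℒ ⌊ n /2⌋            ≡⟨ cong (λ l → 2 * 2 ^ suc l) (⌊log₂⌊n/2⌋⌋≡⌊log₂n⌋∸1 n) ⟩
    2 * 2 ^ suc (⌊log₂ n ⌋ ∸ 1)  ≡⟨ cong (λ l → 2 * 2 ^ l) (m+[n∸m]≡n {1} {⌊log₂ n ⌋} (⌊log₂⌋-mono-≤ {2} {n} (s≤s (s≤s z≤n)))) ⟩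
    2 * 2 ^ ⌊log₂ n ⌋ ∎
    where
    open ≤-Reasoning
    halves : ∀ n → n ≤ suc (2 * ⌊ n /2⌋)
    halves zero = z≤n
    halves (suc zero) = s≤s z≤n
    halves (suc (suc n)) = ≤-trans (s≤s (s≤s (halves n))) (≤-reflexive (lem ⌊ n /2⌋))
      where
      lem : ∀ h → suc (suc (suc (2 * h))) ≡ suc (2 * suc h)
      lem = solve-∀

-- Tilting by 1 + ζ = 4^20 turns the event that μ/20 optimal edges arrive early into a
-- weight of 4^μ, while the mean weight is at most 2^μ.
abstract
  ζ : ℕ
  ζ = 4 ^ 20 ∸ 1

  suc-ζ : suc ζ ≡ 4 ^ 20
  suc-ζ = refl

-- There are at most 196 n insertions into a sparsifier, hence at most 196 n + 1 windows.
capacity : ℕ → ℕ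
capacity n = 4 * suc ζ * (196 * n + 1) * (3 * ℒ n)

-- Index j serves graphs with 2^j γ < m ≤ 2^(j+1) γ, where γ = `capacity n`. The factor 3 * `ℒ n`
-- brings the probability of an alarm at one position to 2^-(3 ℒ n), and 2 * `ℒ n` scales suffice
-- because m ≤ n².
windows : ℕ → List ℕ
windows n = 0 ∷ map (λ j → 3 * ℒ n * 2 ^ suc j) (upTo (2 * ℒ n))

State : ℕ → Set
State n = List (Copy n)

initial : ∀ n → State n
initial n = map start (windows n)

next : State n → Edge n → State n
next {n} ss e = map (λ s → advance (capacity n) s e) ss

stored : State n → List (Edge n)
stored = concatMap λ s → sparse s ++ extra s

open Encoded State (listCode copyCode) initial next (maxMatching ∘ stored) public

foldl-next : ∀ (ss : State n) σ → foldl next ss σ ≡ map (λ s → run (capacity n) s σ) ss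
foldl-next [] [] = refl
foldl-next (s ∷ ss) [] = cong (s ∷_) (foldl-next ss [])
foldl-next {n} ss (e ∷ σ) = trans (foldl-next (next ss e) σ) (sym (map-∘ ss))

k<2^k : ∀ k → k < 2 ^ k
k<2^k zero = s≤s z≤n
k<2^k (suc k) = begin
  suc (suc k)      ≤⟨ +-monoʳ-≤ 1 (k<2^k k) ⟩
  1 + 2 ^ k        ≤⟨ +-monoˡ-≤ (2 ^ k) (m^n>0 2 k) ⟩
  2 ^ k + 2 ^ k    ≡⟨ cong (2 ^ k +_) (+-identityʳ (2 ^ k)) ⟨
  2 * 2 ^ k ∎
  where open ≤-Reasoning

-- The exponent 5 is 3 + 2: 3 ℒ n < 2^(3 ℒ n), and the power of two is at most 2^(2 ℒ n).
windows< : ∀ n → All (λ α → α < 2 ^ (5 * ℒ n)) (windows n)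
windows< n = m^n>0 2 (5 * ℒ n) ∷ All.map⁺ (All.tabulate λ {j} j∈ → bound j (∈-upTo⁻ j∈))
  where
  open ≤-Reasoning
  lem : ∀ l → 3 * l + 2 * l ≡ 5 * l
  lem = solve-∀
  bound : ∀ j → j < 2 * ℒ n → 3 * ℒ n * 2 ^ suc j < 2 ^ (5 * ℒ n)
  bound j j< = begin-strict
    3 * ℒ n * 2 ^ suc j                ≤⟨ *-monoʳ-≤ (3 * ℒ n) (^-monoʳ-≤ 2 j<) ⟩
    3 * ℒ n * 2 ^ (2 * ℒ n)            <⟨ *-monoˡ-< (2 ^ (2 * ℒ n)) {{m^n≢0 2 (2 * ℒ n)}} (k<2^k (3 * ℒ n)) ⟩
    2 ^ (3 * ℒ n) * 2 ^ (2 * ℒ n)      ≡⟨ ^-distribˡ-+-* 2 (3 * ℒ n) (2 * ℒ n) ⟨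
    2 ^ (3 * ℒ n + 2 * ℒ n)            ≡⟨ cong (2 ^_) (lem (ℒ n)) ⟩
    2 ^ (5 * ℒ n) ∎

length-windows : ∀ n → length (windows n) ≡ 1 + 2 * ℒ n
length-windows n = cong suc (trans (length-map _ (upTo (2 * ℒ n))) (length-upTo (2 * ℒ n)))

-- The memory bound

EdgeOf : List (Edge n) → Edge n → Set
EdgeOf E e = Proper e × e ∈ E

record Healthy (E : List (Edge n)) (ss : State n) : Set where
  field
    copies : length ss ≡ 1 + 2 * ℒ n
    sound : All (Sound (EdgeOf E) (capacity n)) ss
    windows-small : All (λ s → window s < 2 ^ (5 * ℒ n)) ss

window-advance : ∀ γ (s : Copy n) e → window (advance γ s e) ≡ window s
window-advance γ (copy α zero H X) e = refl
window-advance γ (copy α (suc c) H X) e with underfull H e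
... | true = refl
... | false = refl

healthy-initial : ∀ (E : List (Edge n)) → Healthy E (initial n)
healthy-initial {n} E = record
  { copies = trans (length-map start (windows n)) (length-windows n)
  ; sound = All.map⁺ (All.tabulate λ {α} _ → sound-start (EdgeOf E) (capacity n) α)
  ; windows-small = All.map⁺ (windows< n) }

healthy-next : ∀ {E : List (Edge n)} {ss e} → EdgeOf E e → Healthy E ss → Healthy E (next ss e)
healthy-next {n} {E} {ss} {e} pe h = record
  { copies = trans (length-map _ ss) copies
  ; sound = All.map⁺ (All.map (sound-advance (proj₁ pe) pe) sound)
  ; windows-small = All.map⁺ (All.map (λ {s} → subst (_< 2 ^ (5 * ℒ n)) (sym (window-advance (capacity n) s e))) windows-small) }
  where open Healthy h

edge-length : ∀ (e : Edge n) → length (Code.enc edgeCode e) ≤ (1 + 2 * ℒ n) + (1 + 2 * ℒ n)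
edge-length {n} (a , b) = ≤-trans (≤-reflexive (length-++ (Code.enc finCode a))) (+-mono-≤ (vertex a) (vertex b))
  where
  vertex : ∀ (v : Fin n) → length (Code.enc finCode v) ≤ 1 + 2 * ℒ n
  vertex v = nat-length (toℕ v) (ℒ n) (<-trans (Fin.toℕ<n v) (n<2^ℒ n))

edges-length : ∀ (H : List (Edge n)) {k} → length H ≤ k → length (encList edgeCode H) ≤ 1 + k * (3 + 4 * ℒ n)
edges-length {n} H H≤k = ≤-trans (list-length edgeCode _ H (All.tabulate λ {e} _ → edge-length e))
  (s≤s (*-mono-≤ H≤k (≤-reflexive (lem (ℒ n)))))
  where
  lem : ∀ l → 1 + ((1 + 2 * l) + (1 + 2 * l)) ≡ 3 + 4 * l
  lem = solve-∀

copy-length : ∀ {P : Edge n → Set} {s} → Sound P (capacity n) s → window s < 2 ^ (5 * ℒ n) →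
  length (Code.enc copyCode s) ≤ ((1 + 2 * (5 * ℒ n)) + (1 + 2 * (5 * ℒ n))) + ((1 + 196 * n * (3 + 4 * ℒ n)) + (1 + capacity n * (3 + 4 * ℒ n)))
copy-length {n} {s = s} S w< = ≤-trans (≤-reflexive (trans
    (length-++ (Code.enc natCode (window s) ++ Code.enc natCode (wait s)))
    (cong₂ _+_ (length-++ (Code.enc natCode (window s))) (length-++ (encList edgeCode (sparse s))))))
  (+-mono-≤ (+-mono-≤ (nat-length (window s) (5 * ℒ n) w<) (nat-length (wait s) (5 * ℒ n) (≤-<-trans wait≤ w<)))
            (+-mono-≤ (edges-length (sparse s) (≤-trans (m≤m+n _ fuel) (Budget.small budget))) (edges-length (extra s) extra≤)))
  where open Sound S

abstract
  memoryFactor : ℕ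
  memoryFactor = 24 + 196 * 7 + 4 * suc ζ * 196 * 3 * 7

  memoryFactor-def : memoryFactor ≡ 24 + 196 * 7 + 4 * suc ζ * 196 * 3 * 7
  memoryFactor-def = refl

-- The dominant term is X, with O(n log n) edges of O(log n) bits each.
copy-bound : ∀ n → ((1 + 2 * (5 * ℒ n)) + (1 + 2 * (5 * ℒ n))) + ((1 + 196 * n * (3 + 4 * ℒ n)) + (1 + capacity n * (3 + 4 * ℒ n)))
  ≤ memoryFactor * ((n + 1) * (ℒ n * ℒ n))
copy-bound n = begin
  ((1 + 2 * (5 * L)) + (1 + 2 * (5 * L))) + ((1 + 196 * n * (3 + 4 * L)) + (1 + 4 * y * (196 * n + 1) * (3 * L) * (3 + 4 * L)))
    ≡⟨ lem₁ L (196 * n * (3 + 4 * L)) (4 * y * (196 * n + 1) * (3 * L) * (3 + 4 * L)) ⟩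
  (4 + 20 * L) + 196 * n * (3 + 4 * L) + 4 * y * (196 * n + 1) * (3 * L) * (3 + 4 * L)
    ≤⟨ +-mono-≤ (+-mono-≤ constants (*-mono-≤ (*-monoʳ-≤ 196 (m≤m+n n 1)) 3+4L≤)) (*-mono-≤ (*-monoˡ-≤ (3 * L) (*-monoʳ-≤ (4 * y) 196n+1≤)) 3+4L≤) ⟩
  24 * L + 196 * v * (7 * L) + 4 * y * (196 * v) * (3 * L) * (7 * L)
    ≤⟨ +-monoˡ-≤ (4 * y * (196 * v) * (3 * L) * (7 * L)) (+-mono-≤ (*-monoʳ-≤ 24 L≤) grow) ⟩
  24 * (v * (L * L)) + 196 * v * (7 * (L * L)) + 4 * y * (196 * v) * (3 * L) * (7 * L)
    ≡⟨ lem₂ 24 196 7 4 3 v L y ⟩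
  (24 + 196 * 7 + 4 * y * 196 * 3 * 7) * (v * (L * L))
    ≡⟨ cong (_* (v * (L * L))) memoryFactor-def ⟨
  memoryFactor * (v * (L * L)) ∎
  where
  open ≤-Reasoning
  L = ℒ n
  y = suc ζ
  v = n + 1
  lem₁ : ∀ L a b → ((1 + 2 * (5 * L)) + (1 + 2 * (5 * L))) + ((1 + a) + (1 + b)) ≡ (4 + 20 * L) + a + b
  lem₁ = solve-∀
  lem₂ : ∀ a k s f t v L y → a * (v * (L * L)) + k * v * (s * (L * L)) + f * y * (k * v) * (t * L) * (s * L)
    ≡ (a + k * s + f * y * k * t * s) * (v * (L * L))
  lem₂ = solve-∀
  lem₃ : ∀ l → 4 * suc l + 20 * suc l ≡ 24 * suc l
  lem₃ = solve-∀
  lem₄ : ∀ l → 3 * suc l + 4 * suc l ≡ 7 * suc l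
  lem₄ = solve-∀
  constants : 4 + 20 * L ≤ 24 * L
  constants = ≤-trans (+-monoˡ-≤ (20 * L) (*-monoʳ-≤ 4 {1} {L} (s≤s z≤n))) (≤-reflexive (lem₃ _))
  3+4L≤ : 3 + 4 * L ≤ 7 * L
  3+4L≤ = ≤-trans (+-monoˡ-≤ (4 * L) (*-monoʳ-≤ 3 {1} {L} (s≤s z≤n))) (≤-reflexive (lem₄ _))
  196n+1≤ : 196 * n + 1 ≤ 196 * v
  196n+1≤ = ≤-trans (+-monoʳ-≤ (196 * n) (m≤m+n 1 195)) (≤-reflexive (sym (*-distribˡ-+ 196 n 1)))
  L≤LL : L ≤ L * L
  L≤LL = m≤m*n L L
  L≤ : L ≤ v * (L * L)
  L≤ = ≤-trans L≤LL (≤-trans (≤-reflexive (sym (*-identityˡ (L * L)))) (*-monoˡ-≤ (L * L) (m≤n+m 1 n)))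
  grow : 196 * v * (7 * L) ≤ 196 * v * (7 * (L * L))
  grow = *-monoʳ-≤ (196 * v) (*-monoʳ-≤ 7 L≤LL)

-- The third logarithmic factor is the number 1 + 2 ℒ n of copies.
state-length : ∀ {E : List (Edge n)} {ss : State n} → Healthy E ss →
  length (encList copyCode ss) ≤ memBound (4 + 3 * memoryFactor) 3 n
state-length {n} {E} {ss} h = begin
  length (encList copyCode ss)                 ≤⟨ list-length copyCode (m * (v * (L * L))) ss
                                                    (All.map (λ (S , w) → ≤-trans (copy-length S w) (copy-bound n)) (All.zip (sound , windows-small))) ⟩
  1 + length ss * (1 + m * (v * (L * L)))      ≡⟨ cong (λ k → 1 + k * (1 + m * (v * (L * L)))) copies ⟩
  1 + (1 + 2 * L) * (1 + m * (v * (L * L)))    ≤⟨ +-mono-≤ 1≤ (*-mono-≤ 1+2L≤ (+-monoˡ-≤ (m * (v * (L * L))) 1≤vLL)) ⟩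
  v * (L * (L * L)) + 3 * L * (v * (L * L) + m * (v * (L * L))) ≡⟨ lem v L m ⟩
  (4 + 3 * m) * v * (L * (L * (L * 1))) ∎
  where
  open ≤-Reasoning
  open Healthy h
  L = ℒ n
  v = n + 1
  m = memoryFactor
  lem : ∀ v L m → v * (L * (L * L)) + 3 * L * (v * (L * L) + m * (v * (L * L))) ≡ (4 + 3 * m) * v * (L * (L * (L * 1)))
  lem = solve-∀
  lem₁ : ∀ l → suc l + 2 * suc l ≡ 3 * suc l
  lem₁ = solve-∀
  1≤v : 1 ≤ v
  1≤v = m≤n+m 1 n
  1≤vLL : 1 ≤ v * (L * L)
  1≤vLL = *-mono-≤ 1≤v (*-mono-≤ {1} {L} {1} {L} (s≤s z≤n) (s≤s z≤n))
  1≤ : 1 ≤ v * (L * (L * L))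
  1≤ = *-mono-≤ 1≤v (*-mono-≤ {1} {L} (s≤s z≤n) (*-mono-≤ {1} {L} {1} {L} (s≤s z≤n) (s≤s z≤n)))
  1+2L≤ : 1 + 2 * L ≤ 3 * L
  1+2L≤ = ≤-trans (+-monoˡ-≤ (2 * L) (s≤s z≤n)) (≤-reflexive (lem₁ _))

edges-of : ∀ {E σ : List (Edge n)} → IsBipartiteGraph E → σ ↭ E → All (EdgeOf E) σ
edges-of G σ↭E = All.tabulate λ e∈ → let e∈E = ∈-resp-↭ σ↭E e∈ in All.lookup (simple⇒Proper (proj₁ G)) e∈E , e∈E

memory-bounded : ∀ n (E : List (Edge n)) → IsBipartiteGraph E → ∀ σ → σ ∈ perms E →
  All (λ s → length s ≤ memBound (4 + 3 * memoryFactor) 3 n) (memStates algorithm n σ)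
memory-bounded n E G σ σ∈ = memory-invariant (Healthy E) (EdgeOf E) healthy-next state-length
  (edges-of G (∈-perms⇒↭ E σ∈)) (healthy-initial E)

-- The probability of failure

tilt-^ : ∀ z (V : A → Bool) T σ → tilt z V T σ ≡ suc z ^ count V (take T σ)
tilt-^ z V zero σ = refl
tilt-^ z V (suc T) [] = refl
tilt-^ z V (suc T) (e ∷ σ) with V e
... | true = cong₂ _*_ (cong suc (*-identityˡ z)) (tilt-^ z V T σ)
... | false = trans (*-identityˡ _) (tilt-^ z V T σ)

-- Meant for the empty window, which is always free of insertions, so that only the number of
-- remaining edges can prevent an alarm.
alarms-few : ∀ a γ (H : List (Edge n)) σ → length σ ≤ γ → alarms a γ H σ ≡ 0
alarms-few a γ H [] h = refl
alarms-few a γ H (e ∷ σ) h = cong₂ _+_ quiet (alarms-few a γ (update H e) σ (≤-trans (n≤1+n _) h))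
  where
  quiet : alarm a γ H (e ∷ σ) ≡ 0
  quiet = case bool (γ <ᵇ count (underfull H) (e ∷ σ)) of λ where
    (inj₁ p) → contradiction (≤-trans (count≤length (underfull H) (e ∷ σ)) h) (<⇒≱ (<ᵇ-true p))
    (inj₂ p) → cong (λ b → if b then avoiding (underfull H) a (e ∷ σ) else 0) p

dyadic-scale : ∀ J γ m → γ < m → m ≤ 2 ^ J * γ → ∃ λ j → j < J × 2 ^ j * γ < m × m ≤ 2 ^ suc j * γ
dyadic-scale zero γ m γ<m m≤ = contradiction (≤-trans m≤ (≤-reflexive (*-identityˡ γ))) (<⇒≱ γ<m)
dyadic-scale (suc J) γ m γ<m m≤ with m ≤? 2 ^ J * γ
... | no m≰ = J , ≤-refl , ≰⇒> m≰ , m≤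
... | yes m≤′ = let (j , j< , p , q) = dyadic-scale J γ m γ<m m≤′ in j , m≤n⇒m≤1+n j< , p , q

capacity-nonZero : ∀ n → NonZero (capacity n)
capacity-nonZero n = m*n≢0 (4 * suc ζ * (196 * n + 1)) (3 * ℒ n)
  {{m*n≢0 (4 * suc ζ) (196 * n + 1) {{_}} {{≢-nonZero λ p → 1+n≢0 (trans (+-comm 1 (196 * n)) p)}}}}

module _ {E : List (Edge n)} (G : IsBipartiteGraph E) where

  private
    γ = capacity n
    m = length E
    L = ℒ n

    n≤2^L : n ≤ 2 ^ L
    n≤2^L = <⇒≤ (n<2^ℒ n)

  horizon : ℕ → ℕ
  horizon α = 196 * n * α + α

  succeeds : ∀ {σ} α → σ ∈ perms E → α ∈ windows n → alarms α γ [] σ ≡ 0 →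
    20 * count (optimal G) (take (horizon α) σ) ≤ μ E → success algorithm n E 0ℚ σ ≡ true
  succeeds {σ} α σ∈ α∈ quiet few = subst
    (λ M → isMatchingOf E M ∧ (((ℤ.+ 3 ℚ./ 5) ℚ.- 0ℚ) ℚ.* ℕtoℚ (μ E) ℚ.≤ᵇ ℕtoℚ (length M)) ≡ true)
    (sym (runAlg-algorithm n σ))
    (cong₂ _∧_ (isMatchingOf-maxMatching Q⊆E)
      (three-fifths {μ E} {length (maxMatching Q)} (approximation G σ↭E S Q⊆E (s⊆Q ∘ ∈-++⁺ˡ) (s⊆Q ∘ ∈-++⁺ʳ (sparse s)) few)))
    where
    σ↭E = ∈-perms⇒↭ E σ∈
    final = foldl next (initial n) σ
    Q = stored final
    s = run γ (start α) σ
    S : Split σ s (horizon α)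
    S = run-split γ α σ α [] (196 * n) [] budget-[] (All.map proj₁ (edges-of G σ↭E)) [] refl quiet
    s∈final : s ∈ final
    s∈final = subst (s ∈_) (trans (map-∘ (windows n)) (sym (foldl-next (initial n) σ))) (∈-map⁺ (λ a → run γ (start a) σ) α∈)
    s⊆Q : ∀ {e} → e ∈ sparse s ++ extra s → e ∈ Q
    s⊆Q e∈ = ∈-concatMap⁺ (λ s → sparse s ++ extra s) (lose s∈final e∈)
    healthy : Healthy E final
    healthy = foldl-invariant (Healthy E) (EdgeOf E) healthy-next (edges-of G σ↭E) (healthy-initial E)
    Q⊆E : ∀ {e} → e ∈ Q → e ∈ E
    Q⊆E e∈ =
      let (t , t∈ , e∈t) = find (∈-concatMap⁻ (λ s → sparse s ++ extra s) {xs = final} e∈)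
          sound = All.lookup (Healthy.sound healthy) t∈
      in [ proj₂ ∘ All.lookup (Sound.sparse-P sound) , proj₂ ∘ All.lookup (Sound.extra-P sound) ]′ (∈-++⁻ (sparse t) e∈t)

  fail : List (Edge n) → Bool
  fail σ = not (success algorithm n E 0ℚ σ)

  -- With few edges the copy with an empty window stores the whole graph.
  no-failures : m ≤ γ → failures algorithm n E 0ℚ ≡ 0
  no-failures m≤γ = trans (length-boolFilter fail (perms E))
    (n≤0⇒n≡0 (≤-trans (∑-mono (perms E) λ σ σ∈ → ≤-reflexive (cong (ind ∘ not) (good σ∈))) (≤-reflexive (∑-zero (perms E)))))
    where
    good : ∀ {σ} → σ ∈ perms E → success algorithm n E 0ℚ σ ≡ true
    good {σ} σ∈ = succeeds 0 σ∈ (here refl)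
      (alarms-few 0 γ [] σ (≤-trans (≤-reflexive (↭-length (∈-perms⇒↭ E σ∈))) m≤γ))
      (≤-trans (≤-reflexive (cong (λ T → 20 * count (optimal G) (take T σ)) (trans (+-identityʳ _) (*-zeroʳ (196 * n))))) z≤n)

  -- A failing ordering either has an alarm, paying 4^μ, or more than μ/20 early optimal edges, and
  -- then its tilt is at least (4^20)^(μ/20) = 4^μ.
  failure-charge : ∀ {σ} α → σ ∈ perms E → α ∈ windows n →
    4 ^ μ E * ind (fail σ) ≤ 4 ^ μ E * alarms α γ [] σ + tilt ζ (optimal G) (horizon α) σ
  failure-charge {σ} α σ∈ α∈ = charge (alarms α γ [] σ) refl (20 * c ≤? μ E)
    where
    open ≤-Reasoning
    c = count (optimal G) (take (horizon α) σ)
    charge : ∀ a → alarms α γ [] σ ≡ a → Dec (20 * c ≤ μ E) →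
      4 ^ μ E * ind (fail σ) ≤ 4 ^ μ E * a + tilt ζ (optimal G) (horizon α) σ
    charge (suc a) _ _ = ≤-trans (*-monoʳ-≤ (4 ^ μ E) (≤-trans (ind≤1 (fail σ)) (s≤s z≤n))) (m≤m+n _ _)
    charge zero quiet (yes few) = ≤-trans (≤-reflexive
      (trans (cong (λ b → 4 ^ μ E * ind (not b)) (succeeds α σ∈ α∈ quiet few)) (*-zeroʳ (4 ^ μ E)))) z≤n
    charge zero quiet (no many) = begin
      4 ^ μ E * ind (fail σ)      ≤⟨ *-monoʳ-≤ (4 ^ μ E) (ind≤1 (fail σ)) ⟩
      4 ^ μ E * 1                 ≡⟨ *-identityʳ _ ⟩
      4 ^ μ E                     ≤⟨ ^-monoʳ-≤ 4 (<⇒≤ (≰⇒> many)) ⟩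
      4 ^ (20 * c)                ≡⟨ ^-*-assoc 4 20 c ⟨
      (4 ^ 20) ^ c                ≡⟨ cong (_^ c) suc-ζ ⟨
      suc ζ ^ c                   ≡⟨ tilt-^ ζ (optimal G) (horizon α) σ ⟨
      tilt ζ (optimal G) (horizon α) σ ≤⟨ m≤n+m _ _ ⟩
      4 ^ μ E * 0 + tilt ζ (optimal G) (horizon α) σ ∎

  -- Alarms account for at most m / 2^(3 L) ≤ 1/n of the orderings, as m n ≤ n³ ≤ 2^(3 L). Early
  -- optimal edges account for at most 2^μ / 4^μ ≤ 1/n, as n ≤ 2^L ≤ 2^μ.
  failures-at-scale : ∀ j → γ < m → j < 2 * L → 2 ^ j * γ < m → m ≤ 2 ^ suc j * γ →
    failures algorithm n E 0ℚ * n ≤ 2 * orderings E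
  failures-at-scale j γ<m j< 2^jγ<m m≤2^[1+j]γ = *-cancelˡ-≤ (2 ^ μ E) {{m^n≢0 2 (μ E)}} (begin
    2 ^ μ E * (F * n)                               ≡⟨ lem₁ (2 ^ μ E) F n ⟩
    2 ^ μ E * F * n                                 ≤⟨ *-monoˡ-≤ n halved ⟩
    (2 ^ μ E * SA + m !) * n                        ≡⟨ lem₂ (2 ^ μ E) SA (m !) n ⟩
    2 ^ μ E * (SA * n) + n * m !                    ≤⟨ +-mono-≤ (*-monoʳ-≤ (2 ^ μ E) SA*n≤) (*-monoˡ-≤ (m !) n≤2^μ) ⟩
    2 ^ μ E * m ! + 2 ^ μ E * m !                   ≡⟨ lem₃ (2 ^ μ E) (m !) ⟩
    2 ^ μ E * (2 * m !)                             ≡⟨ cong (λ k → 2 ^ μ E * (2 * k)) (length-perms E) ⟨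
    2 ^ μ E * (2 * orderings E) ∎)
    where
    open ≤-Reasoning
    b = 2 ^ suc j
    α = 3 * L * b
    F = failures algorithm n E 0ℚ
    SA = ∑ (perms E) (alarms α γ [])
    ST = ∑ (perms E) (tilt ζ (optimal G) (horizon α))
    α∈ : α ∈ windows n
    α∈ = there (∈-map⁺ (λ j → 3 * ℒ n * 2 ^ suc j) (∈-upTo⁺ j<))
    lem₁ : ∀ a b c → a * (b * c) ≡ a * b * c
    lem₁ = solve-∀
    lem₂ : ∀ p s f n → (p * s + f) * n ≡ p * (s * n) + n * f
    lem₂ = solve-∀
    lem₃ : ∀ p f → p * f + p * f ≡ p * (2 * f)
    lem₃ = solve-∀
    lem₄ : ∀ k y l p → 2 * (y * (k * (l * (2 * p)) + l * (2 * p))) ≡ 4 * y * (k + 1) * l * p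
    lem₄ = solve-∀
    -- With μ < L the graph would have at most μ n ≤ L n ≤ γ edges.
    L≤μ : L ≤ μ E
    L≤μ = ≮⇒≥ λ μ<L → <⇒≱ γ<m (begin
      m            ≤⟨ edges≤μ*n G ⟩
      μ E * n      ≤⟨ *-monoˡ-≤ n (<⇒≤ μ<L) ⟩
      L * n        ≡⟨ *-comm L n ⟩
      n * L        ≤⟨ *-mono-≤ n≤ (m≤n*m L 3) ⟩
      γ ∎)
      where
      n≤ : n ≤ 4 * suc ζ * (196 * n + 1)
      n≤ = ≤-trans (≤-trans (m≤n*m n 196) (m≤m+n (196 * n) 1)) (m≤n*m (196 * n + 1) (4 * suc ζ))
    n≤2^μ : n ≤ 2 ^ μ E
    n≤2^μ = ≤-trans n≤2^L (^-monoʳ-≤ 2 L≤μ)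
    -- The capacity is chosen for this: with α = 3 L 2^(j+1), the left side is exactly 2^j γ.
    horizon-short : 2 * (suc ζ * horizon α) ≤ m
    horizon-short = begin
      2 * (suc ζ * (196 * n * (3 * L * (2 * 2 ^ j)) + 3 * L * (2 * 2 ^ j)))
        ≡⟨ lem₄ (196 * n) (suc ζ) (3 * L) (2 ^ j) ⟩
      4 * suc ζ * (196 * n + 1) * (3 * L) * 2 ^ j
        ≡⟨ *-comm γ (2 ^ j) ⟩
      2 ^ j * γ
        ≤⟨ <⇒≤ 2^jγ<m ⟩
      m ∎
    ST≤ : ST ≤ 2 ^ μ E * m !
    ST≤ = ≤-trans (∑-tilt≤2^ ζ (optimal G) (horizon α) E horizon-short) (≤-reflexive (cong (λ k → 2 ^ k * m !) (count-optimal G)))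
    charged : 4 ^ μ E * F ≤ 4 ^ μ E * SA + ST
    charged = begin
      4 ^ μ E * F
        ≡⟨ cong (4 ^ μ E *_) (length-boolFilter fail (perms E)) ⟩
      4 ^ μ E * count fail (perms E)
        ≡⟨ ∑-*ˡ (perms E) (4 ^ μ E) (ind ∘ fail) ⟨
      ∑ (perms E) (λ σ → 4 ^ μ E * ind (fail σ))
        ≤⟨ ∑-mono (perms E) (λ σ σ∈ → failure-charge α σ∈ α∈) ⟩
      ∑ (perms E) (λ σ → 4 ^ μ E * alarms α γ [] σ + tilt ζ (optimal G) (horizon α) σ)
        ≡⟨ ∑-+ (perms E) (λ σ → 4 ^ μ E * alarms α γ [] σ) (tilt ζ (optimal G) (horizon α)) ⟩
      ∑ (perms E) (λ σ → 4 ^ μ E * alarms α γ [] σ) + ST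
        ≡⟨ cong (_+ ST) (∑-*ˡ (perms E) (4 ^ μ E) (alarms α γ [])) ⟩
      4 ^ μ E * SA + ST ∎
    4^μ : 4 ^ μ E ≡ 2 ^ μ E * 2 ^ μ E
    4^μ = ^-distribʳ-* (μ E) 2 2
      where
      ^-distribʳ-* : ∀ k a b → (a * b) ^ k ≡ a ^ k * b ^ k
      ^-distribʳ-* zero a b = refl
      ^-distribʳ-* (suc k) a b = trans (cong (a * b *_) (^-distribʳ-* k a b)) (shuffle a b (a ^ k) (b ^ k))
        where
        shuffle : ∀ a b x y → a * b * (x * y) ≡ a * x * (b * y)
        shuffle = solve-∀
    halved : 2 ^ μ E * F ≤ 2 ^ μ E * SA + m !
    halved = *-cancelˡ-≤ (2 ^ μ E) {{m^n≢0 2 (μ E)}} (begin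
      2 ^ μ E * (2 ^ μ E * F)                    ≡⟨ *-assoc (2 ^ μ E) (2 ^ μ E) F ⟨
      2 ^ μ E * 2 ^ μ E * F                      ≡⟨ cong (_* F) 4^μ ⟨
      4 ^ μ E * F                                ≤⟨ ≤-trans charged (+-monoʳ-≤ (4 ^ μ E * SA) ST≤) ⟩
      4 ^ μ E * SA + 2 ^ μ E * m !               ≡⟨ cong (λ k → k * SA + 2 ^ μ E * m !) 4^μ ⟩
      2 ^ μ E * 2 ^ μ E * SA + 2 ^ μ E * m !     ≡⟨ lem₅ (2 ^ μ E) SA (m !) ⟩
      2 ^ μ E * (2 ^ μ E * SA + m !) ∎)
      where
      lem₅ : ∀ p s f → p * p * s + p * f ≡ p * (p * s + f)
      lem₅ = solve-∀
    SA*n≤ : SA * n ≤ m !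
    SA*n≤ = *-cancelˡ-≤ (2 ^ (3 * L)) {{m^n≢0 2 (3 * L)}} (begin
      2 ^ (3 * L) * (SA * n)            ≡⟨ lem₆ (2 ^ (3 * L)) SA n ⟩
      SA * 2 ^ (3 * L) * n              ≤⟨ *-monoˡ-≤ n (∑-alarms b (3 * L) γ {{capacity-nonZero n}} [] E m≤2^[1+j]γ) ⟩
      m * m ! * n                       ≤⟨ *-monoˡ-≤ n (*-monoˡ-≤ (m !) (≤-trans (edges≤n*n G) (*-mono-≤ n≤2^L n≤2^L))) ⟩
      2 ^ L * 2 ^ L * m ! * n           ≤⟨ *-monoʳ-≤ (2 ^ L * 2 ^ L * m !) n≤2^L ⟩
      2 ^ L * 2 ^ L * m ! * 2 ^ L       ≡⟨ lem₇ (2 ^ L) (m !) ⟩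
      2 ^ L * (2 ^ L * (2 ^ L * 1)) * m ! ≡⟨ cong (_* m !) (^-*-assoc 2 L 3) ⟩
      2 ^ (L * 3) * m !                 ≡⟨ cong (λ k → 2 ^ k * m !) (*-comm L 3) ⟩
      2 ^ (3 * L) * m ! ∎)
      where
      lem₆ : ∀ p s n → p * (s * n) ≡ s * p * n
      lem₆ = solve-∀
      lem₇ : ∀ p f → p * p * f * p ≡ p * (p * (p * 1)) * f
      lem₇ = solve-∀

  failure-bound : failures algorithm n E 0ℚ * n ≤ 2 * orderings E
  failure-bound = by-size (m ≤? γ)
    where
    open ≤-Reasoning
    m≤2^2L*γ : m ≤ 2 ^ (2 * L) * γ
    m≤2^2L*γ = begin
      m                      ≤⟨ edges≤n*n G ⟩
      n * n                  ≤⟨ *-mono-≤ n≤2^L n≤2^L ⟩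
      2 ^ L * 2 ^ L          ≡⟨ ^-distribˡ-+-* 2 L L ⟨
      2 ^ (L + L)            ≡⟨ cong (λ k → 2 ^ (L + k)) (+-identityʳ L) ⟨
      2 ^ (2 * L)            ≤⟨ m≤m*n (2 ^ (2 * L)) γ {{capacity-nonZero n}} ⟩
      2 ^ (2 * L) * γ ∎
    by-size : Dec (m ≤ γ) → failures algorithm n E 0ℚ * n ≤ 2 * orderings E
    by-size (yes m≤γ) = ≤-trans (≤-reflexive (cong (_* n) (no-failures m≤γ))) z≤n
    by-size (no m≰γ) =
      let (j , j< , lower , upper) = dyadic-scale (2 * L) γ m (≰⇒> m≰γ) m≤2^2L*γ
      in failures-at-scale j (≰⇒> m≰γ) j< lower upper

theorem1 :
  Σ StreamAlg λ A →
    -- semi-streaming: Õ(n) bits of memory at all times, on every ordering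
    -- of every bipartite graph
    (Σ ℕ λ c → Σ ℕ λ k →
      ∀ (n : ℕ) (E : List (Edge n)) → IsBipartiteGraph E →
        ∀ σ → σ ∈ perms E →
          All (λ s → length s ≤ memBound c k n) (memStates A n σ))
    ×
    -- approximation (3/5 - ε(n)) with ε = o(1), failing with probability
    -- at most C / n^d (d ≥ 1) over a uniformly random ordering
    (Σ (ℕ → ℚ) λ ε → IsLittleOOne ε ×
      (Σ ℕ λ C → Σ ℕ λ d → 1 ≤ d ×
        (∀ (n : ℕ) (E : List (Edge n)) → IsBipartiteGraph E →
          failures A n E (ε n) * n ^ d ≤ C * orderings E)))
theorem1 =
  algorithm
  , (4 + 3 * memoryFactor , 3 , memory-bounded)
  -- The error can be constantly zero because the loss of early edges is paid by the gap between
  -- 12/19 and 3/5.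
  , (λ _ → 0ℚ) , (λ k → 0 , λ _ _ → ℚ.nonNegative⁻¹ (ℤ.+ 1 ℚ./ suc k) {{ℚ.normalize-nonNeg 1 (suc k)}})
  , 2 , 1 , ≤-refl
  , λ n E G → ≤-trans (≤-reflexive (cong (failures algorithm n E 0ℚ *_) (*-identityʳ n))) (failure-bound G)
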